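{- For any data Petri net $\mathcal N=\langle P,T,F,V,guard\rangle$ (with real-valued variables) with initial state $(M_I,\alpha_I)$ and final marking $M_F$, the procedure $\mathrm{RepairDPN}(\mathcal N,(M_I,\alpha_I),M_F)$ terminates.
   Context: **Constraints.** For a set $X$ of variables, $\Phi(X)$ is the set of arithmetic constraints $\varphi ::= \top \mid x\odot y\mid x\odot c\mid \neg\varphi\mid\varphi_1\wedge\varphi_2$ with $x,y\in X$, $c\in\mathbb R$, $\odot\in\{<,=,>\}$, with the usual satisfaction relation $\theta\models\varphi$ for assignments $\theta:X\to\mathbb R$. **Data Petri net (DPN).** A tuple $\mathcal N=\langle P,T,F,V,guard\rangle$ with $P,T$ disjoint sets of places and transitions (finite), $F:(P\times T)\cup(T\times P)\to\mathbb N$, $V$ a finite set of real-valued variables, and $guard:T\to\Phi(V^r\cup V^w)$, where $V^r=\{v^r\mid v\in V\}$ and $V^w=\{v^w\mid v\in V\}$ denote input and output values of variables. $write(t)$ is the set of variables of $V^w$ occurring in $guard(t)$. A marking is $M:P\to\mathbb N$; a valuation is $\alpha:V\to\mathbb R$; a state is a pair $(M,\alpha)$. $M\prec M'$ means $M(p)\le M'(p)$ for all $p$ with strict inequality for some $p$. **Firing, reachability.** $(M,\alpha)[t\rangle(M',\alpha')$ iff $M(p)\ge F(p,t)$ and $M'(p)=M(p)-F(p,t)+F(t,p)$ for all $p$; the assignment $\beta$ with $\beta(v^r)=\alpha(v)$, $\beta(v^w)=\alpha'(v)$ satisfies $guard(t)$; and $\alpha'(v)=\alpha(v)$ whenever $v^w\notin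 write(t)$. The reachable states are those obtained from $(M_I,\alpha_I)$ by finitely many firings. A transition is dead if it fires at no reachable state. **Induced labeled transition system.** $LTS_{\mathcal N}=\langle S,E,s_0\rangle$ has as nodes pairs $(M,A)$, with $M$ a marking and $A$ a set of valuations, generated from the initial node $s_0=(M_I,\{\alpha_I\})$ by the arc rule: $(M,A)\xrightarrow{t}(M',A')$ iff $M(p)\ge F(p,t)$ and $M'(p)=M(p)-F(p,t)+F(t,p)$ for all $p$, and $A'=\{\alpha'\mid \exists\alpha\in A: (M,\alpha)[t\rangle(M',\alpha')\}\neq\emptyset$. Each set $A$ is represented symbolically by a constraint $\phi\in\Phi(V)$ (the constraint of the node) whose satisfying assignments are exactly the elements of $A$. **Coverability graph.** $(M,A)\sqsubset(M',A')$ iff $A=A'$ and $M\prec M'$. The coverability graph of $LTS_{\mathcal N}$ is $\langle S_{CG},E_{CG},s_0\rangle$, where $S_{CG}\subseteq S$ is the set of non-isolated nodes; $s'\in S_{CG}$ is dead if it has no successors in $LTS_{\mathcal N}$ or there is $s\in S_{CG}$ along the path from $s_0$ to $s'$ with $s\sqsubset s'$, and live otherwise; $(s,t,s')\in E_{CG}$ iff $(s,t,s')\in E$ and $s$ is live or is the initial node. Background fact recalled in the paper from earlier work: this graph is finite and effectively constructible. **Colored coverability graph (CCG).** The coverability graph enriched with $c:S_{CG}\to\{\mathtt{red},\mathtt{green}\}$, where, for $s=(M,A)$, $c(s)=\mathtt{green}$ if $M=M_F$ or $s$ has a path to a green node; otherwise $c(s)=\mathtt{red}$. **Refined DPN $\mathcal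 N_R$.** The input condition of a transition $t$ is $\exists\, write(t): guard(t)$ (equivalent to a quantifier-free constraint over $V^r$). For every cycle of $LTS_{\mathcal N}$, every transition $t$ in the cycle with $write(t)\ne\emptyset$ and every transition $t_{out}$ leading out of the cycle, $t$ is split into $t^+$ and $t^-$ (with the same incoming and outgoing arcs as $t$), where $guard(t^+)$ is the conjunction of $guard(t)$ with the input condition of $t_{out}$, and $guard(t^-)$ is the conjunction of $guard(t)$ with the negation of that input condition; here the variables of the input condition of $t_{out}$ stand for the values after $t$ fires, i.e. $v$ is read as $v^w$ if $v^w\in write(t)$ and as $v^r$ otherwise. This is iterated until none of the transitions change. Background fact recalled in the paper from earlier work: for bounded DPNs (those with a uniform bound on the number of tokens in every place over all reachable states) this construction terminates, and $\mathcal N_R$ is behaviorally equivalent to $\mathcal N$. **$\tau$-DPN $\mathcal N_\tau$.** Obtained from $\mathcal N$ by adding, for each $t\in T$ whose guard contains non-trivial input constraints (constraints including variables from $V^r$), a transition $\tau_t$ with guard $\neg(\exists\, write(t): guard(t))$, which requires the same tokens as $t$ and leaves the marking unchanged: $F(p,\tau_t)=F(\tau_t,p)=F(p,t)$ for all $p$. $\mathcal N_{R_\tau}$ denotes the $\tau$-DPN of the refined DPN $\mathcal N_R$. **Procedure MakeRepairStep.** Input: a DPN and its CCG; let $T_\tau$ be its (possibly empty) set of $\tau$-transitions. An arc is critical if its source is green and its target is red. For each critical arc $(s,t,s')$, where $\phi'$ is the constraint of $s'$: (1) if $t\notin T_\tau$, replace $guard(t)$ by its conjunction with $\neg\phi'$;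 (2) if $t\in T_\tau$, consider all simple paths in the CCG leading to $s$, for each take its last arc $(s'',t',s''')$ with $t'\notin T_\tau$, and for each $t'$ so obtained replace $guard(t')$ by its conjunction with $\neg\phi'$. In every restricted guard of a transition $u$, each variable $v$ of an added constraint is replaced by $v^w$ if $v^w\in write(u)$ and by $v^r$ otherwise. Output: the DPN with the modified guards. **Procedure RepairDPN.** Input: a DPN $\mathcal N$ with $(M_I,\alpha_I)$ and $M_F$. Output: a pair (net, $isSuccess$). 1. Construct the CCG of $\mathcal N$ and replace $\mathcal N$ by the result of MakeRepairStep on it. 2. Loop: construct $\mathcal N_{R_\tau}$ for the current net $\mathcal N$, and its CCG. If the CCG contains both green and red nodes, apply MakeRepairStep to $\mathcal N_{R_\tau}$ and its CCG, let the resulting net without the $\tau$-transitions be the new current net, and repeat. If all nodes are green, set $isSuccess=\mathrm{true}$ and go to step 3. If all nodes are red, set $isSuccess=\mathrm{false}$, stop and return the source net. 3. Remove dead transitions (using information from the CCG) and isolated places, merge back the transitions obtained by splitting one transition $t$ in step 2 into a single transition $t$ whose guard is the disjunction of their guards, and return the modified net. -}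

module Defs where

open import Level using (0ℓ; Lift; lift; lower)
open import Axiom.ExcludedMiddle using (ExcludedMiddle)
open import Data.Bool using (Bool; true; false; if_then_else_)
open import Data.Fin using (Fin; zero; suc; _≟_)
open import Data.Fin.Properties using (any?)
open import Data.List using (List; []; _∷_; map; filter; foldl; length; lookup; allFin)
open import Data.List.Membership.Propositional using (_∈_)
import Data.List.Relation.Unary.Any as Any
open import Data.List.Relation.Unary.Any using (Any)
open import Data.List.Relation.Unary.All using (All)
open import Data.List.Relation.Unary.AllPairs using (AllPairs)
open import Data.List.Relation.Unary.Unique.Propositional using (Unique)
open import Data.Maybe using (Maybe; just; nothing)
open import Data.Nat as ℕ using (ℕ; _+_; _∸_)
open import Data.Product using (Σ; ∃; ∃-syntax; _×_; _,_; proj₁; proj₂)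
open import Data.Rational as ℚ using (ℚ)
open import Data.Sum using (_⊎_; inj₁; inj₂; [_,_]′)
import Data.Sum.Properties as Sum
import Data.Unit as Unit
open import Data.Empty using (⊥)
open import Function using (_∘_; id; const; _⇔_)
open import Relation.Binary using (DecidableEquality)
open import Relation.Binary.PropositionalEquality using (_≡_; _≢_; refl)
open import Relation.Nullary using (¬_; Dec; yes; no; does; ¬?; _×-dec_; _⊎-dec_)
open import Relation.Nullary.Decidable using (True; map′)
open import Relation.Unary using (Pred; _≐_)

------------------------------------------------------------------------
-- Real numbers
--
-- A real is the lower set of a Dedekind cut, given by its characteristic
-- function.  The theorem assumes excluded middle, under which every
-- Dedekind cut of ℚ has this form.

record ℝ : Set where
  field
    below     : ℚ → Bool
    inhabited : ∃[ q ] below q ≡ true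
    bounded   : ∃[ q ] below q ≡ false
    downward  : ∀ {p q} → p ℚ.< q → below q ≡ true → below p ≡ true
    rounded   : ∀ {p} → below p ≡ true → ∃[ q ] (p ℚ.< q × below q ≡ true)

open ℝ public

infix 4 _≈ᴿ_ _<ᴿ_

_≈ᴿ_ : ℝ → ℝ → Set
x ≈ᴿ y = ∀ q → below x q ≡ below y q

_<ᴿ_ : ℝ → ℝ → Set
x <ᴿ y = ∃[ q ] (below x q ≡ false × below y q ≡ true)

------------------------------------------------------------------------
-- Constraints

data Comparison : Set where
  lt eq gt : Comparison

⟦_⟧ : Comparison → ℝ → ℝ → Set
⟦ lt ⟧ x y = x <ᴿ y
⟦ eq ⟧ x y = x ≈ᴿ y
⟦ gt ⟧ x y = y <ᴿ x

infixr 6 _∧_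
infixr 5 _∨_

data Φ (X : Set) : Set where
  ⊤̇     : Φ X
  cmpV  : Comparison → X → X → Φ X
  cmpC  : Comparison → X → ℝ → Φ X
  ¬̇_    : Φ X → Φ X
  _∧_   : Φ X → Φ X → Φ X

_∨_ : {X : Set} → Φ X → Φ X → Φ X
φ ∨ ψ = ¬̇ (¬̇ φ ∧ ¬̇ ψ)

⋁ : {X : Set} → List (Φ X) → Φ X
⋁ []           = ¬̇ ⊤̇
⋁ (φ ∷ [])     = φ
⋁ (φ ∷ ψ ∷ ψs) = φ ∨ ⋁ (ψ ∷ ψs)

infix 4 _⊨_

_⊨_ : {X : Set} → (X → ℝ) → Φ X → Set
θ ⊨ ⊤̇          = Unit.⊤
θ ⊨ cmpV o x y = ⟦ o ⟧ (θ x) (θ y)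
θ ⊨ cmpC o x c = ⟦ o ⟧ (θ x) c
θ ⊨ ¬̇ φ        = ¬ (θ ⊨ φ)
θ ⊨ φ ∧ ψ      = (θ ⊨ φ) × (θ ⊨ ψ)

rename : {X Y : Set} → (X → Y) → Φ X → Φ Y
rename f ⊤̇            = ⊤̇
rename f (cmpV o x y) = cmpV o (f x) (f y)
rename f (cmpC o x c) = cmpC o (f x) c
rename f (¬̇ φ)        = ¬̇ rename f φ
rename f (φ ∧ ψ)      = rename f φ ∧ rename f ψ

Occurs : {X : Set} → X → Φ X → Set
Occurs z ⊤̇            = ⊥
Occurs z (cmpV o x y) = z ≡ x ⊎ z ≡ y
Occurs z (cmpC o x c) = z ≡ x
Occurs z (¬̇ φ)        = Occurs z φ
Occurs z (φ ∧ ψ)      = Occurs z φ ⊎ Occurs z ψ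

occurs? : {X : Set} → DecidableEquality X → (z : X) (φ : Φ X) → Dec (Occurs z φ)
occurs? _≟ˣ_ z ⊤̇            = no λ ()
occurs? _≟ˣ_ z (cmpV o x y) = (z ≟ˣ x) ⊎-dec (z ≟ˣ y)
occurs? _≟ˣ_ z (cmpC o x c) = z ≟ˣ x
occurs? _≟ˣ_ z (¬̇ φ)        = occurs? _≟ˣ_ z φ
occurs? _≟ˣ_ z (φ ∧ ψ)      = occurs? _≟ˣ_ z φ ⊎-dec occurs? _≟ˣ_ z ψ

------------------------------------------------------------------------
-- Data Petri nets

-- Vʳ ∪ Vʷ
IOVar : ℕ → Set
IOVar V = Fin V ⊎ Fin V

pattern _ʳ v = inj₁ v
pattern _ʷ v = inj₂ v

_≟ᴵᴼ_ : {V : ℕ} → DecidableEquality (IOVar V)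
_≟ᴵᴼ_ = Sum.≡-dec _≟_ _≟_

Marking : ℕ → Set
Marking P = Fin P → ℕ

Valuation : ℕ → Set
Valuation V = Fin V → ℝ

-- The places are Fin P, the variables Fin V.  The type T of transitions is
-- left open because adding τ-transitions changes it; every net below has
-- finitely many transitions.
record Net (P V : ℕ) (T : Set) : Set where
  field
    F⁻    : Fin P → T → ℕ     -- F(p,t)
    F⁺    : T → Fin P → ℕ     -- F(t,p)
    guard : T → Φ (IOVar V)

open Net public

DPN : (P T V : ℕ) → Set
DPN P T V = Net P V (Fin T)

infix 4 _≺_

_≺_ : {P : ℕ} → Marking P → Marking P → Set
M ≺ M′ = (∀ p → M p ℕ.≤ M′ p) × (∃[ p ] M p ℕ.< M′ p)

module _ {P V : ℕ} {T : Set} (N : Net P V T) where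

  Writes : T → Fin V → Set
  Writes t v = Occurs (v ʷ) (guard N t)

  writes? : (t : T) (v : Fin V) → Dec (Writes t v)
  writes? t v = occurs? _≟ᴵᴼ_ (v ʷ) (guard N t)

  HasInput : T → Set
  HasInput t = ∃[ v ] Occurs (v ʳ) (guard N t)

  hasInput? : (t : T) → Dec (HasInput t)
  hasInput? t = any? λ v → occurs? _≟ᴵᴼ_ (v ʳ) (guard N t)

  -- the variable of guard t standing for the value of v after t fires
  after : T → Fin V → IOVar V
  after t v = if does (writes? t v) then v ʷ else v ʳ

  -- φ is a quantifier-free equivalent of ∃ write(t) : guard(t).  Quantifying
  -- over all of Vʷ is harmless, as the rest of Vʷ does not occur in guard(t).
  IsInputCondition : T → Φ (Fin V) → Set
  IsInputCondition t φ =
    ∀ (α : Valuation V) → α ⊨ φ ⇔ (∃[ α′ ] ([ α , α′ ]′ ⊨ guard N t))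

  Enabled : Marking P → T → Set
  Enabled M t = ∀ p → F⁻ N p t ℕ.≤ M p

  MarkingUpdate : Marking P → T → Marking P → Set
  MarkingUpdate M t M′ = ∀ p → M′ p ≡ (M p ∸ F⁻ N p t) + F⁺ N t p

  Fires : Marking P × Valuation V → T → Marking P × Valuation V → Set
  Fires (M , α) t (M′ , α′) =
    Enabled M t × MarkingUpdate M t M′ ×
    ([ α , α′ ]′ ⊨ guard N t) ×
    (∀ v → ¬ Writes t v → α′ v ≈ᴿ α v)

  data ReachableState (M₀ : Marking P) (α₀ : Valuation V) :
                      Marking P × Valuation V → Set where
    initial : ReachableState M₀ α₀ (M₀ , α₀)
    fire    : ∀ {σ t σ′} → ReachableState M₀ α₀ σ → Fires σ t σ′ →
              ReachableState M₀ α₀ σ′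

  Dead : Marking P → Valuation V → T → Set
  Dead M₀ α₀ t = ∀ σ σ′ → ReachableState M₀ α₀ σ → ¬ Fires σ t σ′

------------------------------------------------------------------------
-- Induced labelled transition system

-- Nodes are compared by _≈ᴺ_, extensional equality of both components; all
-- notions below respect it.
Node : (P V : ℕ) → Set₁
Node P V = Marking P × Pred (Valuation V) 0ℓ

infix 4 _≈ᴺ_ _⊏_

_≈ᴺ_ : {P V : ℕ} → Node P V → Node P V → Set
(M , A) ≈ᴺ (M′ , A′) = (∀ p → M p ≡ M′ p) × A ≐ A′

_⊏_ : {P V : ℕ} → Node P V → Node P V → Set
(M , A) ⊏ (M′ , A′) = A ≐ A′ × M ≺ M′

initialNode : {P V : ℕ} → Marking P → Valuation V → Node P V
initialNode M₀ α₀ = M₀ , λ α → ∀ v → α v ≈ᴿ α₀ v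

module _ {P V : ℕ} {T : Set} (N : Net P V T) where

  Arc : Node P V → T → Node P V → Set
  Arc (M , A) t (M′ , A′) =
    Enabled N M t × MarkingUpdate N M t M′ ×
    (A′ ≐ λ α′ → ∃[ α ] (A α × Fires N (M , α) t (M′ , α′))) ×
    (∃[ α′ ] A′ α′)

  HasSuccessor : Node P V → Set₁
  HasSuccessor s = ∃[ t ] ∃[ s′ ] Arc s t s′

  -- The list records, for each arc of the path, its source and label.
  data Path : Node P V → List (Node P V × T) → Node P V → Set₁ where
    []  : ∀ {s s′} → s ≈ᴺ s′ → Path s [] s′
    _∷_ : ∀ {s t s′ as s″} → Arc s t s′ → Path s′ as s″ →
          Path s ((s , t) ∷ as) s″

  record Cycle (s₀ : Node P V) : Set₁ where
    field
      base      : Node P V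
      arcs      : List (Node P V × T)
      nonempty  : arcs ≢ []
      closed    : Path base arcs base
      distinct  : AllPairs (λ a b → ¬ (proj₁ a ≈ᴺ proj₁ b)) arcs
      reachable : ∃[ as ] Path s₀ as base

  OnCycle : {s₀ : Node P V} → Cycle s₀ → T → Set₁
  OnCycle c t = Any (λ a → proj₂ a ≡ t) (Cycle.arcs c)

  LeadsOut : {s₀ : Node P V} → Cycle s₀ → T → Set₁
  LeadsOut c t =
    ∃[ s′ ] (Any (λ a → Arc (proj₁ a) t s′) (Cycle.arcs c) ×
             All (λ a → ¬ (proj₁ a ≈ᴺ s′)) (Cycle.arcs c))

------------------------------------------------------------------------
-- Colored coverability graph

  module _ (s₀ : Node P V) where

    -- Whether a node is dead depends on the path along which the
    -- construction arrives at it; here the list holds the nodes visited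
    -- strictly before s.
    DeadAt : List (Node P V) → Node P V → Set₁
    DeadAt before s = ¬ HasSuccessor s ⊎ Any (_⊏ s) before

    LiveAt : List (Node P V) → Node P V → Set₁
    LiveAt before s = ¬ DeadAt before s

    data Branch : List (Node P V) → Node P V → Set₁ where
      root   : ∀ {s} → s ≈ᴺ s₀ → Branch [] s
      extend : ∀ {before s t s′} → Branch before s →
               LiveAt before s ⊎ s ≈ᴺ s₀ → Arc s t s′ →
               Branch (s ∷ before) s′

    CGNode : Node P V → Set₁
    CGNode s = ∃[ before ] Branch before s

    CGArc : Node P V → T → Node P V → Set₁
    CGArc s t s′ =
      ∃[ before ] (Branch before s × (LiveAt before s ⊎ s ≈ᴺ s₀) × Arc s t s′)

    data Green (M-F : Marking P) : Node P V → Set₁ where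
      final : ∀ {s} → (∀ p → proj₁ s p ≡ M-F p) → Green M-F s
      via   : ∀ {s t s′} → CGArc s t s′ → Green M-F s′ → Green M-F s

data Color : Set where
  red green : Color

-- The graph as a finite data structure.  Distinct indices are distinct nodes.
record CCG {P V : ℕ} {T : Set} (N : Net P V T)
           (M₀ : Marking P) (α₀ : Valuation V) (M-F : Marking P) : Set₁ where
  private
    s₀ : Node P V
    s₀ = initialNode M₀ α₀
  field
    size          : ℕ
    node          : Fin size → Node P V
    node-sound    : ∀ i → CGNode N s₀ (node i)
    node-complete : ∀ s → CGNode N s₀ s → ∃[ i ] s ≈ᴺ node i
    node-distinct : ∀ i j → node i ≈ᴺ node j → i ≡ j
    start         : Fin size
    start-initial : node start ≈ᴺ s₀
    arcs          : List (Fin size × T × Fin size)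
    arcs-correct  : ∀ i t j → (i , t , j) ∈ arcs ⇔ CGArc N s₀ (node i) t (node j)
    constraint    : Fin size → Φ (Fin V)
    represents    : ∀ i α → α ⊨ constraint i ⇔ proj₂ (node i) α
    color         : Fin size → Color
    color-correct : ∀ i → color i ≡ green ⇔ Green N s₀ M-F (node i)

  data PathTo : Fin size → Set where
    here : PathTo start
    _▷_  : ∀ {i t j} → PathTo i → (i , t , j) ∈ arcs → PathTo j

  visited : ∀ {i} → PathTo i → List (Fin size)
  visited here            = start ∷ []
  visited (_▷_ {j = j} π _) = j ∷ visited π

  Simple : ∀ {i} → PathTo i → Set
  Simple π = Unique (visited π)

  lastNonτ : (T → Bool) → ∀ {i} → PathTo i → Maybe T
  lastNonτ isτ here              = nothing
  lastNonτ isτ (_▷_ {t = t} π _) = if isτ t then lastNonτ isτ π else just t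

  Critical : Fin size × T × Fin size → Set
  Critical (i , _ , j) = color i ≡ green × color j ≡ red

  -- the critical arc requires the guard of u to be restricted
  Restricts : (T → Bool) → Fin size × T × Fin size → T → Set
  Restricts isτ (i , t , _) u =
    (isτ t ≡ false × u ≡ t) ⊎
    (isτ t ≡ true  × Σ (PathTo i) λ π → Simple π × lastNonτ isτ π ≡ just u)

AllGreen AllRed Mixed : {P V : ℕ} {T : Set} {N : Net P V T} {M₀ : Marking P}
  {α₀ : Valuation V} {M-F : Marking P} → CCG N M₀ α₀ M-F → Set
AllGreen G = ∀ i → CCG.color G i ≡ green
AllRed   G = ∀ i → CCG.color G i ≡ red
Mixed    G = (∃[ i ] CCG.color G i ≡ green) × (∃[ i ] CCG.color G i ≡ red)

------------------------------------------------------------------------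
-- τ-DPN

τIndex : {P V : ℕ} {T : Set} → Net P V T → Set
τIndex {T = T} N = Σ T λ t → True (hasInput? N t)

-- cond t is the input condition of t
τ-DPN : {P V : ℕ} {T : Set} (N : Net P V T) → (T → Φ (Fin V)) →
        Net P V (T ⊎ τIndex N)
τ-DPN N cond = record
  { F⁻    = λ p → [ F⁻ N p , (λ τ → F⁻ N p (proj₁ τ)) ]′
  ; F⁺    = [ F⁺ N , (λ τ p → F⁻ N p (proj₁ τ)) ]′
  ; guard = [ guard N , (λ τ → ¬̇ rename _ʳ (cond (proj₁ τ))) ]′
  }

removeτ : {P V : ℕ} {T X : Set} → Net P V (T ⊎ X) → Net P V T
removeτ N = record
  { F⁻    = λ p → F⁻ N p ∘ inj₁
  ; F⁺    = F⁺ N ∘ inj₁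
  ; guard = guard N ∘ inj₁
  }

isτ : {T X : Set} → T ⊎ X → Bool
isτ = [ const false , const true ]′

------------------------------------------------------------------------
-- Splitting transitions

-- A net under repair, each transition labelled by the transition of the
-- source net from which it was obtained by splitting.
record WorkNet (P T V : ℕ) : Set where
  field
    count  : ℕ
    net    : DPN P count V
    origin : Fin count → Fin T

open WorkNet public

-- t⁻ is the new index zero; t⁺ takes over the old index of t.
splitAt : {P T V : ℕ} (W : WorkNet P T V) → Fin (count W) → Φ (Fin V) →
          WorkNet P T V
splitAt {P} {T} {V} W t φ = record
  { count = ℕ.suc (count W)
  ; net = record
    { F⁻    = λ p u → F⁻ (net W) p (old u)
    ; F⁺    = λ u → F⁺ (net W) (old u)
    ; guard = newGuard
    }
  ; origin = origin W ∘ old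
  }
  where
  old : Fin (ℕ.suc (count W)) → Fin (count W)
  old zero    = t
  old (suc u) = u

  φ′ : Φ (IOVar V)
  φ′ = rename (after (net W) t) φ

  newGuard : Fin (ℕ.suc (count W)) → Φ (IOVar V)
  newGuard zero    = guard (net W) t ∧ ¬̇ φ′
  newGuard (suc u) = if does (u ≟ t) then guard (net W) t ∧ φ′ else guard (net W) u

Satisfiable : {X : Set} → Φ X → Set
Satisfiable φ = ∃[ θ ] θ ⊨ φ

-- One split.  If t⁺ or t⁻ has an unsatisfiable guard, the other one is
-- equivalent to t, so t is unchanged and no split is made.
data Splits {P T V : ℕ} (M₀ : Marking P) (α₀ : Valuation V) :
            WorkNet P T V → WorkNet P T V → Set₁ where
  splits : ∀ {W} (c : Cycle (net W) (initialNode M₀ α₀)) {t tₒᵤₜ φ} →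
           OnCycle (net W) c t → (∃[ v ] Writes (net W) t v) →
           LeadsOut (net W) c tₒᵤₜ → IsInputCondition (net W) tₒᵤₜ φ →
           Satisfiable (guard (net W) t ∧ rename (after (net W) t) φ) →
           Satisfiable (guard (net W) t ∧ ¬̇ rename (after (net W) t) φ) →
           Splits M₀ α₀ W (splitAt W t φ)

-- No transition changes any more: the net is its own refinement.
Refined : {P T V : ℕ} → Marking P → Valuation V → WorkNet P T V → Set₁
Refined M₀ α₀ W = ∀ W′ → ¬ Splits M₀ α₀ W W′

------------------------------------------------------------------------
-- The repair procedure

ReturnValue : ℕ → Set
ReturnValue V = (∃[ P ] ∃[ T ] DPN P T V) × Bool

-- Excluded middle is used to compute with properties that are decided
-- classically: which arcs are to be processed, which transitions are dead.
module _ (em : ExcludedMiddle (Level.suc 0ℓ)) where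

  decide : (A : Set) → Dec A
  decide A = map′ lower lift (em {Lift (Level.suc 0ℓ) A})

  MakeRepairStep : {P V : ℕ} {T : Set} (N : Net P V T) {M₀ : Marking P}
    {α₀ : Valuation V} {M-F : Marking P} →
    (T → Bool) → CCG N M₀ α₀ M-F → Net P V T
  MakeRepairStep {V = V} {T = T} N isτ G = record N { guard = newGuard }
    where
    open CCG G

    restrict : T → Φ (IOVar V) → Fin size × T × Fin size → Φ (IOVar V)
    restrict u ψ (_ , _ , j) = ψ ∧ ¬̇ rename (after N u) (constraint j)

    newGuard : T → Φ (IOVar V)
    newGuard u = foldl (restrict u) (guard N u)
      (filter (λ a → decide (Critical a × Restricts isτ a u)) arcs)

  module _ {P T V : ℕ} (M₀ : Marking P) (α₀ : Valuation V) where

    removeAndMerge : DPN P T V → WorkNet P T V → ∃[ P′ ] ∃[ T′ ] DPN P′ T′ V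
    removeAndMerge source W = length places , length kept , record
      { F⁻    = λ p k → F⁻ source (lookup places p) (lookup kept k)
      ; F⁺    = λ k p → F⁺ source (lookup kept k) (lookup places p)
      ; guard = λ k → ⋁ (map (guard (net W)) (parts (lookup kept k)))
      }
      where
      alive : List (Fin (count W))
      alive = filter (λ u → ¬? (decide (Dead (net W) M₀ α₀ u))) (allFin (count W))

      parts : Fin T → List (Fin (count W))
      parts t = filter (λ u → origin W u ≟ t) alive

      kept : List (Fin T)
      kept = filter (λ t → Any.any? (λ u → origin W u ≟ t) alive) (allFin T)

      Isolated : Fin P → Set
      Isolated p = All (λ t → F⁻ source p t ≡ 0 × F⁺ source t p ≡ 0) kept

      places : List (Fin P)
      places = filter (λ p → ¬? (decide (Isolated p))) (allFin P)

  module RepairDPN {P T V : ℕ} (N : DPN P T V)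
                   (M-I : Marking P) (α-I : Valuation V) (M-F : Marking P) where

    data State : Set where
      begin   : State
      looping : WorkNet P T V → State
      return  : ReturnValue V → State

    infix 4 _⟶_

    -- The steps are nondeterministic in the order of splits and in the
    -- constraints chosen to represent sets of valuations.
    data _⟶_ : State → State → Set₁ where

      prepare : (G : CCG N M-I α-I M-F) →
        begin ⟶ looping (record { net    = MakeRepairStep N (const false) G
                                ; origin = id })

      refine : ∀ {W W′} → Splits M-I α-I W W′ → looping W ⟶ looping W′

      repair : ∀ {W} → Refined M-I α-I W →
        ∀ {cond} → (∀ t → IsInputCondition (net W) t (cond t)) →
        (G : CCG (τ-DPN (net W) cond) M-I α-I M-F) → Mixed G →
        looping W ⟶
        looping (record W { net = removeτ (MakeRepairStep (τ-DPN (net W) cond) isτ G) })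

      succeed : ∀ {W} → Refined M-I α-I W →
        ∀ {cond} → (∀ t → IsInputCondition (net W) t (cond t)) →
        (G : CCG (τ-DPN (net W) cond) M-I α-I M-F) → AllGreen G →
        looping W ⟶ return (removeAndMerge M-I α-I N W , true)

      fail : ∀ {W} → Refined M-I α-I W →
        ∀ {cond} → (∀ t → IsInputCondition (net W) t (cond t)) →
        (G : CCG (τ-DPN (net W) cond) M-I α-I M-F) → AllRed G →
        looping W ⟶ return ((P , T , N) , false)

    -- Every execution from the given state reaches a return state after
    -- finitely many steps; in particular none gets stuck.
    data TerminatesFrom : State → Set₁ where
      returned : ∀ {r} → TerminatesFrom (return r)
      continue : ∀ {σ} → (∃[ σ′ ] σ ⟶ σ′) →
                 (∀ σ′ → σ ⟶ σ′ → TerminatesFrom σ′) → TerminatesFrom σ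

    Terminates : Set₁
    Terminates = TerminatesFrom begin

module Submission where

-- Every set of valuations that occurs is invariant under order isomorphisms fixing the constants of
-- the guards and of the initial valuation: one-point extension of finite partial isomorphisms of ℝ
-- gives this for images under firing and for input conditions.  There are finitely many order
-- types, so invariant sets are definable and finite in number, and by Dickson's lemma the
-- coverability graph always exists.
--
-- Let k(t) be the number of order types satisfying the guard of t.  A split divides k(t) into two
-- positive parts.  A repair step never increases any k(t), and decreases one: a critical arc exists
-- because green propagates backwards, and a valuation at its red target violates the restricted
-- guard; for a τ-arc this guard belongs to the last non-τ arc before it, which exists because
-- τ-arcs from the initial node are loops.  Hence Σ (2 k(t) ∸ 1) decreases along the loop.

open import Level using (0ℓ)
open import Axiom.ExcludedMiddle using (ExcludedMiddle)
open import Data.Bool using (Bool; true; false)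
open import Data.Empty using (⊥; ⊥-elim)
open import Data.Fin as Fin using (Fin; zero; suc)
import Data.Fin.Properties as Fin
open import Data.List using (List; []; _∷_; map; filter; foldl; length; lookup; allFin; _++_; concatMap;
  cartesianProduct; cartesianProductWith; deduplicate)
open import Data.List.Membership.Propositional using (_∈_; lose; find)
open import Data.List.Membership.Propositional.Properties
open import Data.List.Relation.Binary.Subset.Propositional using (_⊆_)
open import Data.List.Relation.Unary.All as All using (All; []; _∷_)
import Data.List.Relation.Unary.All.Properties as All
open import Data.List.Relation.Unary.Unique.DecSetoid.Properties using (deduplicate-!)
open import Data.List.Relation.Unary.AllPairs using (AllPairs; []; _∷_)
open import Data.List.Relation.Unary.Any as Any using (Any; here; there)
import Data.List.Relation.Unary.Any.Properties as Any
open import Data.Maybe using (just)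
open import Data.Nat as ℕ using (ℕ; zero; suc; _+_; _∸_; _*_; z≤n; s≤s)
import Data.List.Properties as List
open import Data.Nat.Tactic.RingSolver using (solve-∀)
import Data.Nat.Properties as ℕ
open import Algebra.Properties.CommutativeSemigroup
  ℕ.+-commutativeSemigroup using (x∙yz≈y∙xz)
open import Algebra.Properties.Monoid.Sum ℕ.+-0-monoid using (sum)
import Data.Nat.Induction as ℕ
open import Induction.WellFounded using (Acc; acc)
open import Data.Product using (Σ; ∃; ∃-syntax; _×_; _,_; proj₁; proj₂)
open import Data.Rational as ℚ using (ℚ)
import Data.Rational.Properties as ℚ
open import Data.Sum using (_⊎_; inj₁; inj₂; [_,_]′)
open import Data.Unit using (⊤; tt)
open import Function using (_∘_; id; const; _⇔_; mk⇔; Equivalence)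
open import Relation.Binary using (tri<; tri≈; tri>; DecSetoid)
open import Relation.Binary.PropositionalEquality
  using (_≡_; _≢_; refl; sym; trans; cong; subst; subst₂)
open import Relation.Nullary using (¬_; Dec; yes; no; does; contradiction)
open import Relation.Nullary.Decidable using (True; decidable-stable; dec-true; dec-false)
open import Relation.Unary using (_≐_)
open import Defs

open Equivalence using (to; from)

-- The order of the reals

below-separates : ∀ x {q r} → below x q ≡ true → below x r ≡ false → q ℚ.< r
below-separates x {q} {r} q<x r≮x with ℚ.<-cmp q r
... | tri< q<r _ _ = q<r
... | tri≈ _ refl _ = contradiction (trans (sym q<x) r≮x) λ ()
... | tri> _ _ r<q = contradiction (trans (sym (downward x r<q q<x)) r≮x) λ ()

<ᴿ-irrefl : ∀ x y → x ≈ᴿ y → ¬ x <ᴿ y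
<ᴿ-irrefl _ _ e (q , q≮x , q<y) = contradiction (trans (sym q<y) (trans (sym (e q)) q≮x)) λ ()

<ᴿ-asym : ∀ x y → x <ᴿ y → ¬ y <ᴿ x
<ᴿ-asym x y (q , q≮x , q<y) (r , r≮y , r<x) =
  ℚ.<-asym (below-separates y q<y r≮y) (below-separates x r<x q≮x)

<ᴿ-trans : ∀ x y z → x <ᴿ y → y <ᴿ z → x <ᴿ z
<ᴿ-trans x y z (q , q≮x , q<y) (r , r≮y , r<z) = r , r≮x , r<z
  where
  r≮x : below x r ≡ false
  r≮x with below x r in eq
  ... | false = refl
  ... | true  = contradiction
    (trans (sym (downward x (below-separates y q<y r≮y) eq)) q≮x) λ ()

⟦⟧-resp-≈ : ∀ o {x x′ y y′} → x ≈ᴿ x′ → y ≈ᴿ y′ → ⟦ o ⟧ x y → ⟦ o ⟧ x′ y′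
⟦⟧-resp-≈ lt e f (q , a , b) = q , trans (sym (e q)) a , trans (sym (f q)) b
⟦⟧-resp-≈ eq e f h q = trans (sym (e q)) (trans (h q) (f q))
⟦⟧-resp-≈ gt e f (q , a , b) = q , trans (sym (f q)) a , trans (sym (e q)) b

⟦⟧-unique : ∀ o o′ {x y} → ⟦ o ⟧ x y → ⟦ o′ ⟧ x y → o ≡ o′
⟦⟧-unique lt lt a b = refl
⟦⟧-unique lt eq {x} {y} a b = contradiction a (<ᴿ-irrefl x y b)
⟦⟧-unique lt gt {x} {y} a b = contradiction a (<ᴿ-asym y x b)
⟦⟧-unique eq lt {x} {y} a b = contradiction b (<ᴿ-irrefl x y a)
⟦⟧-unique eq eq a b = refl
⟦⟧-unique eq gt {x} {y} a b = contradiction b (<ᴿ-irrefl y x (λ q → sym (a q)))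
⟦⟧-unique gt lt {x} {y} a b = contradiction a (<ᴿ-asym x y b)
⟦⟧-unique gt eq {x} {y} a b = contradiction a (<ᴿ-irrefl y x (λ q → sym (b q)))
⟦⟧-unique gt gt a b = refl

converse : Comparison → Comparison
converse lt = gt
converse eq = eq
converse gt = lt

⟦⟧-converse : ∀ o {x y} → ⟦ o ⟧ x y → ⟦ converse o ⟧ y x
⟦⟧-converse lt a = a
⟦⟧-converse eq a q = sym (a q)
⟦⟧-converse gt a = a

does⇒ : ∀ {A : Set} (a? : Dec A) → does a? ≡ true → A
does⇒ (yes a) _ = a

fromℚ : ℚ → ℝ
fromℚ r = record
  { below     = λ q → does (q ℚ.<? r)
  ; inhabited = r ℚ.- ℚ.1ℚ , dec-true (_ ℚ.<? r)
      (subst (r ℚ.- ℚ.1ℚ ℚ.<_) (ℚ.+-identityʳ r) (ℚ.+-monoʳ-< r (ℚ.negative⁻¹ (ℚ.- ℚ.1ℚ))))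
  ; bounded   = r , dec-false (r ℚ.<? r) (ℚ.<-irrefl refl)
  ; downward  = λ {p} {q} p<q q<r → dec-true (p ℚ.<? r) (ℚ.<-trans p<q (witness q<r))
  ; rounded   = λ p<r → let q , p<q , q<r = ℚ.<-dense (witness p<r)
                        in q , p<q , dec-true (q ℚ.<? r) q<r
  }
  where
  witness : ∀ {q} → does (q ℚ.<? r) ≡ true → q ℚ.< r
  witness {q} = does⇒ (q ℚ.<? r)

-- Separation of finite sets of reals

BelowAll AboveAll : ℚ → List ℝ → Set
BelowAll q = All λ u → below u q ≡ true
AboveAll q = All λ l → below l q ≡ false

BelowAll-downward : ∀ {p q us} → p ℚ.< q → BelowAll q us → BelowAll p us
BelowAll-downward p<q = All.map λ {u} → downward u p<q

AboveAll-upward : ∀ {p q ls} → p ℚ.< q → AboveAll p ls → AboveAll q ls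
AboveAll-upward {p} {q} p<q = All.map λ {l} → above l
  where
  above : ∀ l → below l p ≡ false → below l q ≡ false
  above l p≮l with below l q in e
  ... | false = refl
  ... | true  = contradiction (trans (sym (downward l p<q e)) p≮l) λ ()

-- Any predicate on ℚ is closed under binary minima.
meet : (S : ℚ → Set) → ∃ S → ∀ {us} → All (λ u → ∃[ q ] (S q × below u q ≡ true)) us →
       ∃[ q ] (S q × BelowAll q us)
meet S (q , s) [] = q , s , []
meet S s {u ∷ _} ((q , sq , q<u) ∷ hs) with meet S s hs
... | r , sr , r<us with ℚ.<-cmp q r
...   | tri< q<r _ _  = q , sq , q<u ∷ BelowAll-downward q<r r<us
...   | tri≈ _ refl _ = q , sq , q<u ∷ r<us
...   | tri> _ _ r<q  = r , sr , downward u r<q q<u ∷ r<us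

-- The rational is a maximum taken along `ls`: each `l` contributes a rational outside its own cut
-- and inside all of `us`, and the larger of it and the previous one keeps both properties.
separate : ∀ ls us → All (λ l → All (l <ᴿ_) us) ls → ∃[ q ] (AboveAll q ls × BelowAll q us)
separate [] us [] =
  let q , _ , q<us = meet (const ⊤) (ℚ.0ℚ , tt)
                       (All.universal (λ u → let q , e = inhabited u in q , tt , e) us)
  in q , [] , q<us
separate (l ∷ ls) us (l<us ∷ ls<us)
  with separate ls us ls<us | meet (λ q → below l q ≡ false) (bounded l) l<us
... | q , ls≤q , q<us | r , l≤r , r<us with ℚ.<-cmp q r
...   | tri< q<r _ _  = r , l≤r ∷ AboveAll-upward q<r ls≤q , r<us
...   | tri≈ _ refl _ = r , l≤r ∷ ls≤q , q<us
...   | tri> _ _ r<q  = q , All.head (AboveAll-upward {ls = l ∷ []} r<q (l≤r ∷ [])) ∷ ls≤q , q<us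

opaque
  between : ∀ ls us → All (λ l → All (l <ᴿ_) us) ls → ∃[ b ] (All (_<ᴿ b) ls × All (b <ᴿ_) us)
  between ls us ls<us with separate ls us ls<us
  ... | q , ls≤q , q<us
    -- `separate` gives only a weak inequality between `ls` and `q`; a larger rational still inside
    -- all of `us` makes both sides strict. The default `q + 1` serves when `us` is empty.
    with meet (q ℚ.<_) (q ℚ.+ ℚ.1ℚ , subst (ℚ._< q ℚ.+ ℚ.1ℚ) (ℚ.+-identityʳ q)
                                        (ℚ.+-monoʳ-< q (ℚ.positive⁻¹ ℚ.1ℚ)))
              (All.map (λ {u} → rounded u) q<us)
  ... | r , q<r , r<us = fromℚ r
    , All.map (λ l≤q → q , l≤q , dec-true (q ℚ.<? r) q<r) ls≤q
    , All.map (λ r<u → r , dec-false (r ℚ.<? r) (ℚ.<-irrefl refl) , r<u) r<us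

-- Finite partial order isomorphisms of ℝ

-- One common comparison stands for agreement on all three: the comparisons exclude one another, so
-- `Same-transport` recovers the rest.
Same : ℝ × ℝ → ℝ × ℝ → Set
Same (x , x′) (y , y′) = ∃[ o ] (⟦ o ⟧ x y × ⟦ o ⟧ x′ y′)

Same-flip : ∀ {p q} → Same p q → Same q p
Same-flip (o , a , b) = converse o , ⟦⟧-converse o a , ⟦⟧-converse o b

Same-transport : ∀ {x x′ y y′} o → Same (x , x′) (y , y′) → ⟦ o ⟧ x y → ⟦ o ⟧ x′ y′
Same-transport o (o′ , a , b) h with ⟦⟧-unique o′ o a h
... | refl = b

Same-sym : ∀ {x x′ y y′} → Same (x , x′) (y , y′) → Same (x′ , x) (y′ , y)
Same-sym (o , a , b) = o , b , a

-- Since equality is among the comparisons, the pairs form a well-defined and injective partial map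
-- up to `≈ᴿ`.
Iso : List (ℝ × ℝ) → Set
Iso L = ∀ p q → p ∈ L → q ∈ L → Same p q

module _ (em : ExcludedMiddle (Level.suc 0ℓ)) where

  compare : ∀ x y → ∃[ o ] ⟦ o ⟧ x y
  compare x y with decide em (x <ᴿ y) | decide em (y <ᴿ x)
  ... | yes x<y | _       = lt , x<y
  ... | no  _   | yes y<x = gt , y<x
  ... | no  x≮y | no  y≮x = eq , λ q → same q
    where
    same : ∀ q → below x q ≡ below y q
    same q with below x q in ex | below y q in ey
    ... | true  | true  = refl
    ... | true  | false = contradiction (q , ey , ex) y≮x
    ... | false | true  = contradiction (q , ex , ey) x≮y
    ... | false | false = refl

  -- The forth step of a back-and-forth argument. A point equal to an old one takes the old image;
  -- otherwise the images of the points below `a` lie below the images of the points above `a`, and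
  -- density leaves room for `b`.
  Iso-extend : ∀ {L} → Iso L → ∀ a → ∃[ b ] Iso ((a , b) ∷ L)
  Iso-extend {L} iso a = proj₁ image , isoₑ
    where
    fits : ∃[ b ] (∀ {q} → q ∈ L → Same (a , b) q)
    fits with decide em (∃[ p ] (p ∈ L × a ≈ᴿ proj₁ p))
    ... | yes ((p , p′) , p∈L , a≈p) = p′ , λ q∈L →
      let o , s , s′ = iso _ _ p∈L q∈L in o , ⟦⟧-resp-≈ o (λ r → sym (a≈p r)) (λ _ → refl) s , s′
    ... | no fresh = b , side
      where
      lower? : (p : ℝ × ℝ) → Dec (proj₁ p <ᴿ a)
      lower? p = decide em _
      upper? : (p : ℝ × ℝ) → Dec (a <ᴿ proj₁ p)
      upper? p = decide em _
      ls us : List ℝ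
      ls = map proj₂ (filter lower? L)
      us = map proj₂ (filter upper? L)
      ordered : ∀ {l u} → l ∈ ls → u ∈ us → l <ᴿ u
      ordered l∈ u∈ with ∈-map∘filter⁻ proj₂ lower? l∈ | ∈-map∘filter⁻ proj₂ upper? u∈
      ... | (x , x′) , x∈L , refl , x<a | (y , y′) , y∈L , refl , a<y =
        Same-transport lt (iso _ _ x∈L y∈L) (<ᴿ-trans x a y x<a a<y)
      gap : ∃[ b ] (All (_<ᴿ b) ls × All (b <ᴿ_) us)
      gap = between ls us (All.tabulate λ l∈ → All.tabulate (ordered l∈))
      b : ℝ
      b = proj₁ gap
      side : ∀ {q} → q ∈ L → Same (a , b) q
      side {q} q∈L with compare a (proj₁ q)
      ... | eq , h = contradiction (q , q∈L , h) fresh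
      ... | lt , h = lt , h , All.lookup (proj₂ (proj₂ gap))
                                (∈-map∘filter⁺ proj₂ upper? (q , q∈L , refl , h))
      ... | gt , h = gt , h , All.lookup (proj₁ (proj₂ gap))
                                (∈-map∘filter⁺ proj₂ lower? (q , q∈L , refl , h))
    image : ∃[ b ] (∀ {q} → q ∈ L → Same (a , b) q)
    image = fits
    isoₑ : Iso ((a , proj₁ image) ∷ L)
    isoₑ _ _ (here refl) (here refl) = eq , (λ _ → refl) , (λ _ → refl)
    isoₑ _ _ (here refl) (there q∈)  = proj₂ image q∈
    isoₑ _ _ (there p∈)  (here refl) = Same-flip (proj₂ image p∈)
    isoₑ _ _ (there p∈)  (there q∈)  = iso _ _ p∈ q∈

  Iso-extendAll : ∀ {L} → Iso L → ∀ {n} (a : Fin n → ℝ) →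
    Σ (Fin n → ℝ) λ b → ∃[ L′ ] (Iso L′ × L ⊆ L′ × (∀ i → (a i , b i) ∈ L′))
  Iso-extendAll iso {zero} a = (λ ()) , _ , iso , id , λ ()
  Iso-extendAll {L} iso {suc n} a with Iso-extend iso (a zero)
  ... | b₀ , iso₀ with Iso-extendAll iso₀ (a ∘ suc)
  ... | b , L′ , iso′ , L⊆L′ , b∈ = b′ , L′ , iso′ , L⊆L′ ∘ there , b′∈
    where
    b′ : Fin (suc n) → ℝ
    b′ zero    = b₀
    b′ (suc i) = b i
    b′∈ : ∀ i → (a i , b′ i) ∈ L′
    b′∈ zero    = L⊆L′ (here refl)
    b′∈ (suc i) = b∈ i

-- Constraints over a finite set of constants

⊨-rename : ∀ {X Y : Set} (f : X → Y) φ {θ : Y → ℝ} → θ ⊨ rename f φ ⇔ (θ ∘ f) ⊨ φ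
⊨-rename f ⊤̇            = mk⇔ id id
⊨-rename f (cmpV o x y) = mk⇔ id id
⊨-rename f (cmpC o x c) = mk⇔ id id
⊨-rename f (¬̇ φ)        =
  mk⇔ (λ h → h ∘ from (⊨-rename f φ)) (λ h → h ∘ to (⊨-rename f φ))
⊨-rename f (φ ∧ ψ)      =
  mk⇔ (λ (a , b) → to (⊨-rename f φ) a , to (⊨-rename f ψ) b)
      (λ (a , b) → from (⊨-rename f φ) a , from (⊨-rename f ψ) b)

constants : {X : Set} → Φ X → List ℝ
constants ⊤̇            = []
constants (cmpV o x y) = []
constants (cmpC o x c) = c ∷ []
constants (¬̇ φ)        = constants φ
constants (φ ∧ ψ)      = constants φ ++ constants ψ

module OrderType (C : List ℝ) where

  infix 4 _∼_

  -- Equality of quantifier-free types over the parameters `C`: sending each `θ x` to `θ′ x` and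
  -- fixing `C` preserves and reflects the order.
  record _∼_ {X : Set} (θ θ′ : X → ℝ) : Set where
    constructor mk∼
    field
      variables : ∀ x y → Same (θ x , θ′ x) (θ y , θ′ y)
      constant  : ∀ x {c} → c ∈ C → Same (θ x , θ′ x) (c , c)

  open _∼_ public

  ∼-sym : ∀ {X : Set} {θ θ′ : X → ℝ} → θ ∼ θ′ → θ′ ∼ θ
  ∼-sym e = mk∼ (λ x y → Same-sym (variables e x y)) (λ x c∈ → Same-sym (constant e x c∈))

  ∼-reindex : ∀ {X Y : Set} {θ θ′ : X → ℝ} (f : Y → X) → θ ∼ θ′ → (θ ∘ f) ∼ (θ′ ∘ f)
  ∼-reindex f e = mk∼ (λ x y → variables e (f x) (f y)) (λ x → constant e (f x))

  Invariant : {X : Set} → ((X → ℝ) → Set) → Set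
  Invariant A = ∀ {θ θ′} → θ ∼ θ′ → A θ → A θ′

  InvariantΦ : {X : Set} → Φ X → Set
  InvariantΦ φ = Invariant (_⊨ φ)

  constants⊆⇒invariant : ∀ {X : Set} (φ : Φ X) → constants φ ⊆ C → InvariantΦ φ
  constants⊆⇒invariant ⊤̇ _ _ h = h
  constants⊆⇒invariant (cmpV o x y) _ e h = Same-transport o (variables e x y) h
  constants⊆⇒invariant (cmpC o x c) s e h = Same-transport o (constant e x (s (here refl))) h
  constants⊆⇒invariant (¬̇ φ) s e h = h ∘ constants⊆⇒invariant φ s (∼-sym e)
  constants⊆⇒invariant (φ ∧ ψ) s e (h , k) =
    constants⊆⇒invariant φ (s ∘ ∈-++⁺ˡ) e h ,
    constants⊆⇒invariant ψ (s ∘ ∈-++⁺ʳ (constants φ)) e k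

  invariant-∧ : ∀ {X : Set} (φ ψ : Φ X) → InvariantΦ φ → InvariantΦ ψ → InvariantΦ (φ ∧ ψ)
  invariant-∧ φ ψ i j e (h , k) = i e h , j e k

  invariant-¬ : ∀ {X : Set} (φ : Φ X) → InvariantΦ φ → InvariantΦ (¬̇ φ)
  invariant-¬ φ i e h = h ∘ i (∼-sym e)

  invariant-rename : ∀ {X Y : Set} (f : X → Y) φ → InvariantΦ φ → InvariantΦ (rename f φ)
  invariant-rename f φ i e h = from (⊨-rename f φ) (i (∼-reindex f e) (to (⊨-rename f φ) h))

  invariant-⇔ : ∀ {X : Set} {A B : (X → ℝ) → Set} → (∀ θ → A θ ⇔ B θ) →
                Invariant A → Invariant B
  invariant-⇔ A⇔B i {θ} {θ′} e h = to (A⇔B θ′) (i e (from (A⇔B θ) h))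

  module _ (em : ExcludedMiddle (Level.suc 0ℓ)) where

    ≈⇒∼ : ∀ {X : Set} {θ θ′ : X → ℝ} → (∀ x → θ x ≈ᴿ θ′ x) → θ ∼ θ′
    ≈⇒∼ {θ = θ} e = mk∼
      (λ x y → let o , h = compare em (θ x) (θ y) in o , h , ⟦⟧-resp-≈ o (e x) (e y) h)
      (λ x {c} _ → let o , h = compare em (θ x) c in o , h , ⟦⟧-resp-≈ o (e x) (λ _ → refl) h)

    -- The pairs of values of `α` and `β`, together with the pairs `(c , c)`, form a finite partial
    -- isomorphism, which extends to the values of `α′` point by point.
    ∼-amalgamate : ∀ {m n} {α β : Fin m → ℝ} → α ∼ β → (α′ : Fin n → ℝ) →
                   ∃[ β′ ] [ α , α′ ]′ ∼ [ β , β′ ]′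
    ∼-amalgamate {m} {n} {α} {β} e α′ with Iso-extendAll em iso α′
      where
      vs cs : List (ℝ × ℝ)
      vs = map (λ v → α v , β v) (allFin m)
      cs = map (λ c → c , c) C
      iso : Iso (vs ++ cs)
      iso _ _ p∈ q∈ with ∈-++⁻ vs p∈ | ∈-++⁻ vs q∈
      iso _ _ _ _ | inj₁ p∈ | inj₁ q∈ with ∈-map⁻ _ p∈ | ∈-map⁻ _ q∈
      ... | x , _ , refl | y , _ , refl = variables e x y
      iso _ _ _ _ | inj₁ p∈ | inj₂ q∈ with ∈-map⁻ _ p∈ | ∈-map⁻ _ q∈
      ... | x , _ , refl | c , c∈ , refl = constant e x c∈
      iso _ _ _ _ | inj₂ p∈ | inj₁ q∈ with ∈-map⁻ _ p∈ | ∈-map⁻ _ q∈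
      ... | c , c∈ , refl | y , _ , refl = Same-flip (constant e y c∈)
      iso _ _ _ _ | inj₂ p∈ | inj₂ q∈ with ∈-map⁻ _ p∈ | ∈-map⁻ _ q∈
      ... | c , _ , refl | d , _ , refl = let o , h = compare em c d in o , h , h
    ... | β′ , L , iso , ⊆L , β′∈ = β′ , mk∼ (λ x y → iso _ _ (∈L x) (∈L y)) (λ x c∈ → iso _ _ (∈L x)
            (⊆L (∈-++⁺ʳ _ (∈-map⁺ _ c∈))))
      where
      ∈L : ∀ x → ([ α , α′ ]′ x , [ β , β′ ]′ x) ∈ L
      ∈L (inj₁ v) = ⊆L (∈-++⁺ˡ (∈-map⁺ _ (∈-allFin v)))
      ∈L (inj₂ v) = β′∈ v

    invariant-∃ : ∀ {m n} {A : (Fin m ⊎ Fin n → ℝ) → Set} →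
                  Invariant A → Invariant (λ α → ∃[ α′ ] A [ α , α′ ]′)
    invariant-∃ i e (α′ , h) = let β′ , e′ = ∼-amalgamate e α′ in β′ , i e′ h

-- Sets that are invariant under agreement on finitely many constraints

Agree : {X : Set} → List (Φ X) → (θ θ′ : X → ℝ) → Set
Agree L θ θ′ = All (λ φ → θ ⊨ φ ⇔ θ′ ⊨ φ) L

Agree-sym : ∀ {X : Set} {L : List (Φ X)} {θ θ′} → Agree L θ θ′ → Agree L θ′ θ
Agree-sym = All.map λ e → mk⇔ (from e) (to e)

Agree-trans : ∀ {X : Set} {L : List (Φ X)} {θ θ′ θ″} →
              Agree L θ θ′ → Agree L θ′ θ″ → Agree L θ θ″
Agree-trans p q = All.zipWith (λ (e , f) → mk⇔ (to f ∘ to e) (from e ∘ from f)) (p , q)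

-- Shannon expansion with respect to `φ`, so that every Boolean function of `L` is listed up to
-- equivalence.
booleanCombinations : {X : Set} → List (Φ X) → List (Φ X)
booleanCombinations []      = ⊤̇ ∷ (¬̇ ⊤̇) ∷ []
booleanCombinations (φ ∷ L) = cartesianProductWith (λ ψ χ → (φ ∧ ψ) ∨ (¬̇ φ ∧ χ))
                                (booleanCombinations L) (booleanCombinations L)

module _ (em : ExcludedMiddle (Level.suc 0ℓ)) where

  ⊨-∨ : ∀ {X : Set} {θ : X → ℝ} φ ψ → θ ⊨ φ ∨ ψ ⇔ (θ ⊨ φ ⊎ θ ⊨ ψ)
  ⊨-∨ {θ = θ} φ ψ = mk⇔ ⇒ ⇐
    where
    ⇒ : θ ⊨ φ ∨ ψ → θ ⊨ φ ⊎ θ ⊨ ψ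
    ⇒ h with decide em (θ ⊨ φ) | decide em (θ ⊨ ψ)
    ... | yes a | _     = inj₁ a
    ... | no  _ | yes b = inj₂ b
    ... | no  a | no  b = contradiction (a , b) h
    ⇐ : θ ⊨ φ ⊎ θ ⊨ ψ → θ ⊨ φ ∨ ψ
    ⇐ (inj₁ a) (¬a , _) = ¬a a
    ⇐ (inj₂ b) (_ , ¬b) = ¬b b

  -- Induction on `L`. `A` splits into its parts inside and outside `φ`, and closing each part under
  -- agreement on `L` makes it definable from `L`. Conjunction with `φ` or its negation undoes the
  -- closure, because `A` respects agreement on `φ` and `L` together.
  definable : ∀ {X : Set} (L : List (Φ X)) (A : (X → ℝ) → Set) →
    (∀ {θ θ′} → Agree L θ θ′ → A θ → A θ′) →
    ∃[ φ ] (φ ∈ booleanCombinations L × (∀ θ → θ ⊨ φ ⇔ A θ))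
  -- Over the empty list all assignments agree, so `A` is everything or nothing.
  definable [] A inv with decide em (∃ A)
  ... | yes (θ , a) = ⊤̇ , here refl , λ θ′ → mk⇔ (λ _ → inv [] a) (λ _ → tt)
  ... | no ¬A = ¬̇ ⊤̇ , there (here refl) , λ θ → mk⇔ (λ h → ⊥-elim (h tt)) (λ a _ → ¬A (θ , a))
  definable {X} (φ ∷ L) A inv =
    _ , ∈-cartesianProductWith⁺ _ (proj₁ (proj₂ pos)) (proj₁ (proj₂ neg)) , correct
    where
    Near : ((X → ℝ) → Set) → (X → ℝ) → Set
    Near S θ = ∃[ θ′ ] (Agree L θ′ θ × S θ′ × A θ′)
    near : ∀ S → ∃[ ψ ] (ψ ∈ booleanCombinations L × (∀ θ → θ ⊨ ψ ⇔ Near S θ))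
    near S = definable L (Near S) λ e (θ′ , e′ , s , a) → θ′ , Agree-trans e′ e , s , a
    pos : ∃[ ψ ] (ψ ∈ booleanCombinations L × (∀ θ → θ ⊨ ψ ⇔ Near (_⊨ φ) θ))
    pos = near (_⊨ φ)
    neg : ∃[ ψ ] (ψ ∈ booleanCombinations L × (∀ θ → θ ⊨ ψ ⇔ Near (_⊨ ¬̇ φ) θ))
    neg = near (_⊨ ¬̇ φ)
    ψ χ : Φ X
    ψ = proj₁ pos
    χ = proj₁ neg
    agree : ∀ {θ} → Agree L θ θ
    agree = All.universal (λ _ → mk⇔ id id) L
    correct : ∀ θ → θ ⊨ (φ ∧ ψ) ∨ (¬̇ φ ∧ χ) ⇔ A θ
    correct θ = mk⇔ (⇒ ∘ to (⊨-∨ (φ ∧ ψ) (¬̇ φ ∧ χ))) (from (⊨-∨ (φ ∧ ψ) (¬̇ φ ∧ χ)) ∘ ⇐)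
      where
      ⇒ : θ ⊨ φ ∧ ψ ⊎ θ ⊨ ¬̇ φ ∧ χ → A θ
      ⇒ (inj₁ (p , h)) = let θ′ , e , p′ , a = to (proj₂ (proj₂ pos) θ) h in
        inv (mk⇔ (const p) (const p′) ∷ e) a
      ⇒ (inj₂ (p , h)) = let θ′ , e , p′ , a = to (proj₂ (proj₂ neg) θ) h in
        inv (mk⇔ (λ q → contradiction q p′) (λ q → contradiction q p) ∷ e) a
      ⇐ : A θ → θ ⊨ φ ∧ ψ ⊎ θ ⊨ ¬̇ φ ∧ χ
      ⇐ a with decide em (θ ⊨ φ)
      ... | yes p = inj₁ (p , from (proj₂ (proj₂ pos) θ) (θ , agree , p , a))
      ... | no  p = inj₂ (p , from (proj₂ (proj₂ neg) θ) (θ , agree , p , a))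

-- Definability of invariant sets and representatives of order types

module Definability (em : ExcludedMiddle (Level.suc 0ℓ)) (C : List ℝ)
                    {X : Set} {xs : List X} (xs-complete : ∀ x → x ∈ xs) where

  open OrderType C

  comparisons : List Comparison
  comparisons = lt ∷ eq ∷ gt ∷ []

  comparisons-complete : ∀ o → o ∈ comparisons
  comparisons-complete lt = here refl
  comparisons-complete eq = there (here refl)
  comparisons-complete gt = there (there (here refl))

  variableAtom : Comparison → X × X → Φ X
  variableAtom o (x , y) = cmpV o x y

  constantAtom : Comparison → X × ℝ → Φ X
  constantAtom o (x , c) = cmpC o x c

  variableAtoms constantAtoms atoms : List (Φ X)
  variableAtoms = cartesianProductWith variableAtom comparisons (cartesianProduct xs xs)
  constantAtoms = cartesianProductWith constantAtom comparisons (cartesianProduct xs C)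
  atoms         = variableAtoms ++ constantAtoms

  cmpV∈atoms : ∀ o x y → cmpV o x y ∈ atoms
  cmpV∈atoms o x y = ∈-++⁺ˡ (∈-cartesianProductWith⁺ variableAtom (comparisons-complete o)
                       (∈-cartesianProduct⁺ (xs-complete x) (xs-complete y)))

  cmpC∈atoms : ∀ o x {c} → c ∈ C → cmpC o x c ∈ atoms
  cmpC∈atoms o x c∈ = ∈-++⁺ʳ variableAtoms
    (∈-cartesianProductWith⁺ constantAtom (comparisons-complete o)
      (∈-cartesianProduct⁺ (xs-complete x) c∈))

  agree-atoms⇒∼ : ∀ {θ θ′ : X → ℝ} → Agree atoms θ θ′ → θ ∼ θ′
  agree-atoms⇒∼ {θ} {θ′} e = mk∼ vs cs
    where
    vs : ∀ x y → Same (θ x , θ′ x) (θ y , θ′ y)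
    vs x y with compare em (θ x) (θ y)
    ... | o , h = o , h , to (All.lookup e (cmpV∈atoms o x y)) h
    cs : ∀ x {c} → c ∈ C → Same (θ x , θ′ x) (c , c)
    cs x {c} c∈ with compare em (θ x) c
    ... | o , h = o , h , to (All.lookup e (cmpC∈atoms o x c∈)) h

  opaque
    candidates : List (Φ X)
    candidates = booleanCombinations atoms

    invariant⇒definable : ∀ (A : (X → ℝ) → Set) → Invariant A →
      ∃[ φ ] (φ ∈ candidates × (∀ θ → θ ⊨ φ ⇔ A θ))
    invariant⇒definable A inv = definable em atoms A (inv ∘ agree-atoms⇒∼)

    covered : ∀ (L : List (Φ X)) → ∃[ R ] (∀ {φ} → φ ∈ L → Satisfiable φ → ∃[ θ ] (θ ∈ R × θ ⊨ φ))
    covered [] = [] , λ ()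
    covered (φ ∷ L) with decide em (Satisfiable φ) | covered L
    ... | yes (θ , h) | R , cov = θ ∷ R , λ
      { (here refl) _ → θ , here refl , h
      ; (there φ∈) s  → let θ′ , θ′∈ , h′ = cov φ∈ s in θ′ , there θ′∈ , h′ }
    ... | no ¬s | R , cov = R , λ
      { (here refl) s → contradiction s ¬s
      ; (there φ∈) s  → cov φ∈ s }

    -- The list meets every order type. Some may be met repeatedly, which is harmless: the counts
    -- taken later are additive over any list, and positivity only requires each type to be met.
    representatives : List (X → ℝ)
    representatives = proj₁ (covered candidates)

    -- The assignments agreeing with `θ` on all atoms are themselves defined by a candidate, and the
    -- witness kept for this candidate has the order type of `θ`.
    representative : ∀ θ → ∃[ r ] (r ∈ representatives × r ∼ θ)
    representative θ =
      let φ , φ∈ , φ⇔ = definable em atoms (λ θ′ → Agree atoms θ′ θ)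
                          (λ e h → Agree-trans (Agree-sym e) h)
          r , r∈ , h = proj₂ (covered candidates) φ∈
                         (θ , from (φ⇔ θ) (All.universal (λ _ → mk⇔ id id) atoms))
      in r , r∈ , agree-atoms⇒∼ (to (φ⇔ r) h)

-- Dickson's lemma

module _ (em : ExcludedMiddle (Level.suc 0ℓ)) where

  least : (Q : ℕ → Set) → ∃ Q → ∃[ n ] (Q n × (∀ m → Q m → n ℕ.≤ m))
  least Q (n , q) = go n (ℕ.<-wellFounded n) q
    where
    go : ∀ n → Acc ℕ._<_ n → Q n → ∃[ n ] (Q n × (∀ m → Q m → n ℕ.≤ m))
    go n (acc rs) q with decide em (∃[ m ] (m ℕ.< n × Q m))
    ... | yes (m , m<n , q′) = go m (rs m<n) q′
    ... | no  ∄m = n , q , λ m q′ → ℕ.≮⇒≥ λ m<n → ∄m (m , m<n , q′)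

  argmin : (f : ℕ → ℕ) → ∀ n → ∃[ k ] (n ℕ.≤ k × (∀ m → n ℕ.≤ m → f k ℕ.≤ f m))
  argmin f n with least (λ v → ∃[ k ] (n ℕ.≤ k × f k ≡ v)) (f n , n , ℕ.≤-refl , refl)
  ... | _ , (k , n≤k , refl) , minimal = k , n≤k , λ m n≤m → minimal (f m) (m , n≤m , refl)

  Increasing : (ℕ → ℕ) → Set
  Increasing g = ∀ n → g n ℕ.< g (suc n)

  increasing⇒< : ∀ {g} → Increasing g → ∀ {i j} → i ℕ.< j → g i ℕ.< g j
  increasing⇒< inc {i} {suc j} (s≤s i≤j) with ℕ.m≤n⇒m<n∨m≡n i≤j
  ... | inj₁ i<j  = ℕ.<-trans (increasing⇒< inc i<j) (inc j)
  ... | inj₂ refl = inc j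

  -- Each index minimizes `f` on the tail after the previous choice, and that tail contains all
  -- later choices.
  monotone-subsequence : (f : ℕ → ℕ) → ∃[ g ] (Increasing g × (∀ {i j} → i ℕ.< j → f (g i) ℕ.≤ f (g j)))
  monotone-subsequence f = g , inc , mono
    where
    bound g : ℕ → ℕ
    bound zero    = 0
    bound (suc n) = suc (g n)
    g n = proj₁ (argmin f (bound n))
    bound≤ : ∀ n → bound n ℕ.≤ g n
    bound≤ n = proj₁ (proj₂ (argmin f (bound n)))
    inc : Increasing g
    inc n = bound≤ (suc n)
    mono : ∀ {i j} → i ℕ.< j → f (g i) ℕ.≤ f (g j)
    mono {i} {j} i<j = proj₂ (proj₂ (argmin f (bound i))) (g j)
      (ℕ.≤-trans (bound≤ i) (ℕ.<⇒≤ (increasing⇒< inc i<j)))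

  opaque
    -- Induction on the number of coordinates: a subsequence monotone in all coordinates but the
    -- first is thinned once more for the first, which keeps the others monotone.
    dickson : ∀ m (h : ℕ → Fin m → ℕ) →
      ∃[ g ] (Increasing g × (∀ {i j} → i ℕ.< j → ∀ p → h (g i) p ℕ.≤ h (g j) p))
    dickson zero h = id , (λ n → ℕ.n<1+n n) , λ _ ()
    dickson (suc m) h with dickson m (λ n → h n ∘ suc)
    ... | g₁ , inc₁ , mono₁ with monotone-subsequence (λ n → h (g₁ n) zero)
    ... | g₂ , inc₂ , mono₂ = g₁ ∘ g₂ , (λ n → increasing⇒< inc₁ (inc₂ n)) , λ
      { i<j zero    → mono₂ i<j
      ; i<j (suc p) → mono₁ (increasing⇒< inc₂ i<j) p }

-- The latest element of a sequence is the head of the list.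
data Bar {S : Set₁} (R : S → S → Set) (bs : List S) : Set₁ where
  bar : (∀ s → ¬ Any (λ b → R b s) bs → Bar R (s ∷ bs)) → Bar R bs

module _ (em : ExcludedMiddle (Level.suc 0ℓ)) {S : Set₁} (R : S → S → Set) where

  opaque
    -- If `Bar` failed, each failing list would have a failing extension by an unrelated element.
    -- Iterating this from the empty list gives an infinite sequence without a good pair.
    bar-[] : (∀ (f : ℕ → S) → ∃[ i ] ∃[ j ] (i ℕ.< j × R (f i) (f j))) → Bar R []
    bar-[] good = decidable-stable em λ ¬bar →
      let i , j , i<j , r = good (head ¬bar) in
      proj₁ (proj₂ (next ¬bar j)) (lose (earlier ¬bar i<j) r)
      where
      escape : ∀ {bs} → ¬ Bar R bs → ∃[ s ] (¬ Any (λ b → R b s) bs × ¬ Bar R (s ∷ bs))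
      escape ¬bar = decidable-stable em λ ∄s →
        ¬bar (bar λ s ¬r → decidable-stable em λ ¬bar′ → ∄s (s , ¬r , ¬bar′))
      chain : ¬ Bar R [] → ℕ → ∃[ bs ] ¬ Bar R bs
      chain ¬bar zero    = [] , ¬bar
      chain ¬bar (suc n) = let bs , ¬bar′ = chain ¬bar n
                               s , _ , ¬bar″ = escape ¬bar′ in s ∷ bs , ¬bar″
      next : (¬bar : ¬ Bar R []) (n : ℕ) → let bs = proj₁ (chain ¬bar n) in
             ∃[ s ] (¬ Any (λ b → R b s) bs × ¬ Bar R (s ∷ bs))
      next ¬bar n = escape (proj₂ (chain ¬bar n))
      head : ¬ Bar R [] → ℕ → S
      head ¬bar n = proj₁ (next ¬bar n)
      earlier : ∀ ¬bar {i j} → i ℕ.< j → head ¬bar i ∈ proj₁ (chain ¬bar j)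
      earlier ¬bar {i} {suc j} (s≤s i≤j) with ℕ.m≤n⇒m<n∨m≡n i≤j
      ... | inj₁ i<j  = there (earlier ¬bar i<j)
      ... | inj₂ refl = here refl

-- The labelled transition system

≈ᴺ-refl : ∀ {P V} {s : Node P V} → s ≈ᴺ s
≈ᴺ-refl = (λ _ → refl) , id , id

≈ᴺ-sym : ∀ {P V} {s s′ : Node P V} → s ≈ᴺ s′ → s′ ≈ᴺ s
≈ᴺ-sym (m , a , a′) = sym ∘ m , a′ , a

≈ᴺ-trans : ∀ {P V} {s s′ s″ : Node P V} → s ≈ᴺ s′ → s′ ≈ᴺ s″ → s ≈ᴺ s″
≈ᴺ-trans (m , a , a′) (n , b , b′) = (λ p → trans (m p) (n p)) , b ∘ a , a′ ∘ b′

infix 4 _⊑_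

-- The union of `⊏` and `≈ᴺ`. Unlike `⊏`, it is a well-quasi-order on the invariant nodes.
_⊑_ : ∀ {P V} → Node P V → Node P V → Set
(M , A) ⊑ (M′ , A′) = A ≐ A′ × (∀ p → M p ℕ.≤ M′ p)

≈ᴺ⇒⊑ : ∀ {P V} {s s′ : Node P V} → s ≈ᴺ s′ → s ⊑ s′
≈ᴺ⇒⊑ (m , a) = a , ℕ.≤-reflexive ∘ m

⊏-resp-≈ᴺ : ∀ {P V} {s s₁ t t₁ : Node P V} → s ≈ᴺ s₁ → t ≈ᴺ t₁ → s ⊏ t → s₁ ⊏ t₁
⊏-resp-≈ᴺ (m , a , a′) (n , b , b′) ((i , j) , le , p , M<M′) =
  (b ∘ i ∘ a′ , a ∘ j ∘ b′) ,
  (λ q → subst₂ ℕ._≤_ (m q) (n q) (le q)) , p , subst₂ ℕ._<_ (m p) (n p) M<M′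

module _ {P V : ℕ} {T : Set} (N : Net P V T) where

  Fires-resp : ∀ {M M₁ M′ M₁′ : Marking P} {α α′ t} →
    (∀ p → M p ≡ M₁ p) → (∀ p → M′ p ≡ M₁′ p) →
    Fires N (M , α) t (M′ , α′) → Fires N (M₁ , α) t (M₁′ , α′)
  Fires-resp {t = t} m m′ (en , up , rest) =
    (λ p → subst (F⁻ N p t ℕ.≤_) (m p) (en p)) ,
    (λ p → trans (sym (m′ p)) (trans (up p) (cong (λ k → (k ∸ F⁻ N p t) + F⁺ N t p) (m p)))) ,
    rest

  -- Total, whether or not an arc exists: exploration along `post` overapproximates the graph, and
  -- `isCGNode?` discards the surplus.
  post : Node P V → T → Node P V
  post (M , A) t = M′ , λ α′ → ∃[ α ] (A α × Fires N (M , α) t (M′ , α′))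
    where
    M′ : Marking P
    M′ p = (M p ∸ F⁻ N p t) + F⁺ N t p

  Arc-resp : ∀ {s s₁ s′ s₁′ : Node P V} {t} → s ≈ᴺ s₁ → s′ ≈ᴺ s₁′ → Arc N s t s′ → Arc N s₁ t s₁′
  Arc-resp {t = t} (m , a , a′) (m′ , b , b′) (en , up , (i , j) , α′ , α′∈) =
    (λ p → subst (F⁻ N p t ℕ.≤_) (m p) (en p)) ,
    (λ p → trans (sym (m′ p)) (trans (up p) (cong (λ k → (k ∸ F⁻ N p t) + F⁺ N t p) (m p)))) ,
    ( (λ x → let α , α∈ , f = i (b′ x) in α , a α∈ , Fires-resp m m′ f)
    , (λ (α , α∈ , f) → b (j (α , a′ α∈ , Fires-resp (sym ∘ m) (sym ∘ m′) f)))) ,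
    α′ , b α′∈

  Arc⇒≈post : ∀ {s t s′} → Arc N s t s′ → s′ ≈ᴺ post s t
  Arc⇒≈post (_ , up , (i , j) , _) =
    up ,
    (λ x → let α , α∈ , f = i x in α , α∈ , Fires-resp (λ _ → refl) up f) ,
    (λ (α , α∈ , f) → j (α , α∈ , Fires-resp (λ _ → refl) (sym ∘ up) f))

  HasSuccessor-resp : ∀ {s s₁} → s ≈ᴺ s₁ → HasSuccessor N s → HasSuccessor N s₁
  HasSuccessor-resp e (t , s′ , arc) = t , s′ , Arc-resp e ≈ᴺ-refl arc

  module _ (s₀ : Node P V) where

    LiveAt-resp : ∀ {before s s₁} → s ≈ᴺ s₁ → LiveAt N s₀ before s → LiveAt N s₀ before s₁
    LiveAt-resp e live (inj₁ stuck) = live (inj₁ (stuck ∘ HasSuccessor-resp e))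
    LiveAt-resp e live (inj₂ below) =
      live (inj₂ (Any.map (⊏-resp-≈ᴺ ≈ᴺ-refl (≈ᴺ-sym e)) below))

    Branch-resp : ∀ {before s s₁} → s ≈ᴺ s₁ → Branch N s₀ before s → Branch N s₀ before s₁
    Branch-resp e (root e′)           = root (≈ᴺ-trans (≈ᴺ-sym e) e′)
    Branch-resp e (extend br l arc)   = extend br l (Arc-resp ≈ᴺ-refl e arc)

    CGArc-resp : ∀ {s s₁ t s′ s₁′} → s ≈ᴺ s₁ → s′ ≈ᴺ s₁′ → CGArc N s₀ s t s′ → CGArc N s₀ s₁ t s₁′
    CGArc-resp e e′ (before , br , inj₁ live , arc) =
      before , Branch-resp e br , inj₁ (LiveAt-resp e live) , Arc-resp e e′ arc
    CGArc-resp e e′ (before , br , inj₂ e″ , arc) =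
      before , Branch-resp e br , inj₂ (≈ᴺ-trans (≈ᴺ-sym e) e″) , Arc-resp e e′ arc

    Green-resp : ∀ {M-F s s₁} → s ≈ᴺ s₁ → Green N s₀ M-F s → Green N s₀ M-F s₁
    Green-resp e (final f) = final λ p → trans (sym (proj₁ e p)) (f p)
    Green-resp e (via a g) = via (CGArc-resp e ≈ᴺ-refl a) g

-- The coverability graph

-- A branch of the coverability graph can be pruned to one without repetitions, whose nodes other
-- than the last form a sequence without any ⊑-increasing pair; Dickson's lemma and the finiteness
-- of the number of invariant sets make the tree of such sequences finite.
module CoverabilityGraph (em : ExcludedMiddle (Level.suc 0ℓ)) (C : List ℝ)
  {P V : ℕ} {T : Set} {ts : List T} (ts-complete : ∀ t → t ∈ ts)
  (N : Net P V T) (guards-invariant : ∀ t → OrderType.InvariantΦ C (guard N t))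
  (M₀ : Marking P) (α₀ : Valuation V) (α₀∈C : ∀ v → α₀ v ∈ C)
  where

  open OrderType C
  open Definability em C {xs = allFin V} ∈-allFin

  s₀ : Node P V
  s₀ = initialNode M₀ α₀

  InvariantNode : Node P V → Set
  InvariantNode (M , A) = Invariant A

  opaque
    s₀-invariant : InvariantNode s₀
    s₀-invariant e α≈α₀ v = Same-transport eq (constant e v (α₀∈C v)) (α≈α₀ v)

    -- A predecessor of `β′` has to be found, so amalgamation runs backwards: the correspondence
    -- between the new values is extended to the old ones. `flip` restores the order in which guards
    -- take the two valuations.
    post-invariant : ∀ s t → InvariantNode s → InvariantNode (post N s t)
    post-invariant (M , A) t inv {α′} {β′} e (α , α∈ , en , up , g , frame) =
      let β , e′ = ∼-amalgamate em e α in
      β , inv (∼-reindex inj₂ e′) α∈ , en , up ,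
      guards-invariant t (flip e′) g ,
      λ v ¬w → Same-transport eq (variables e′ (inj₁ v) (inj₂ v)) (frame v ¬w)
      where
      flip : ∀ {α β : Valuation V} → [ α′ , α ]′ ∼ [ β′ , β ]′ → [ α , α′ ]′ ∼ [ β , β′ ]′
      flip e = mk∼
        (λ { (inj₁ x) (inj₁ y) → variables e (inj₂ x) (inj₂ y)
           ; (inj₁ x) (inj₂ y) → variables e (inj₂ x) (inj₁ y)
           ; (inj₂ x) (inj₁ y) → variables e (inj₁ x) (inj₂ y)
           ; (inj₂ x) (inj₂ y) → variables e (inj₁ x) (inj₁ y) })
        (λ { (inj₁ x) → constant e (inj₂ x)
           ; (inj₂ x) → constant e (inj₁ x) })

  invariant-resp : ∀ {s s′} → s ≈ᴺ s′ → InvariantNode s → InvariantNode s′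
  invariant-resp (_ , a , a′) inv e h = a (inv e (a′ h))

  Branch-invariant : ∀ {before s} → Branch N s₀ before s → InvariantNode s
  Branch-invariant (root e) = invariant-resp (≈ᴺ-sym e) s₀-invariant
  Branch-invariant (extend {s = s} {t} br _ arc) =
    invariant-resp (≈ᴺ-sym (Arc⇒≈post N arc)) (post-invariant s t (Branch-invariant br))

  -- The well-quasi-order on invariant nodes

  S : Set₁
  S = ∃ InvariantNode

  _⊑ˢ_ : S → S → Set
  (s , _) ⊑ˢ (s′ , _) = s ⊑ s′

  postˢ : S → T → S
  postˢ (s , inv) t = post N s t , post-invariant s t inv

  definition : ∀ (s : S) → ∃[ φ ] (φ ∈ candidates × (∀ α → α ⊨ φ ⇔ proj₂ (proj₁ s) α))
  definition (_ , inv) = invariant⇒definable _ inv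

  -- Sets with the same defining candidate coincide, so this finite label determines the set of
  -- valuations of a node.
  index : S → Fin (length candidates)
  index s = Any.index (proj₁ (proj₂ (definition s)))

  index-injective : ∀ s s′ → index s ≡ index s′ → ∀ {α} → proj₂ (proj₁ s) α → proj₂ (proj₁ s′) α
  index-injective s s′ e {α} h =
    to (proj₂ (proj₂ (definition s′)) α) (subst (α ⊨_)
      (trans (Any.lookup-index (proj₁ (proj₂ (definition s))))
        (trans (cong (lookup candidates) e)
          (sym (Any.lookup-index (proj₁ (proj₂ (definition s′)))))))
      (from (proj₂ (proj₂ (definition s)) α) h))

  -- Since index s ≤ K, the first two coordinates turn equality of indices into ≤.
  coordinates : S → Fin (2 + P) → ℕ
  coordinates s zero                   = Fin.toℕ (index s)
  coordinates s (suc zero)             = length candidates ∸ Fin.toℕ (index s)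
  coordinates ((M , _) , _) (suc (suc p)) = M p

  coordinates-≤⇒⊑ : ∀ s s′ → (∀ p → coordinates s p ℕ.≤ coordinates s′ p) → s ⊑ˢ s′
  coordinates-≤⇒⊑ s s′ le =
    (index-injective s s′ same , index-injective s′ s (sym same)) , λ p → le (suc (suc p))
    where
    same : index s ≡ index s′
    same = Fin.toℕ-injective (ℕ.≤-antisym (le zero)
      (ℕ.∸-cancelʳ-≤ (ℕ.<⇒≤ (Fin.toℕ<n (index s′))) (le (suc zero))))

  ⊑-good : ∀ (f : ℕ → S) → ∃[ i ] ∃[ j ] (i ℕ.< j × f i ⊑ˢ f j)
  ⊑-good f =
    let g , inc , mono = dickson em (2 + P) (coordinates ∘ f)
    in g 0 , g 1 , inc 0 , coordinates-≤⇒⊑ (f (g 0)) (f (g 1)) (mono {0} {1} (s≤s z≤n))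

  -- Finiteness of the tree of runs and pruning of branches

  s₀ˢ : S
  s₀ˢ = s₀ , s₀-invariant

  -- Domination is tested only when a node is extended, so the last node of a run may dominate an
  -- earlier one, as a dead node of the graph may.
  data Run : List S → S → Set₁ where
    begin : Run [] s₀ˢ
    step  : ∀ {bs s} → Run bs s → ¬ Any (_⊑ˢ s) bs → ∀ t → Run (s ∷ bs) (postˢ s t)

  -- Runs read forwards from a given prefix, the direction in which recursion along `Bar` proceeds.
  data Continuation : List S → S → S → Set₁ where
    halt : ∀ {bs s} → Continuation bs s s
    step : ∀ {bs s x} → ¬ Any (_⊑ˢ s) bs → ∀ t →
           Continuation (s ∷ bs) (postˢ s t) x → Continuation bs s x

  Run⇒Continuation : ∀ {bs s x} → Run bs s → Continuation bs s x → Continuation [] s₀ˢ x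
  Run⇒Continuation begin         c = c
  Run⇒Continuation (step r ¬⊑ t) c = Run⇒Continuation r (step ¬⊑ t c)

  -- Recursion along the bar: branching is over the finite list `ts`, and every extension descends
  -- one step in the bar.
  continuations-finite : ∀ {bs} → Bar _⊑ˢ_ bs → ∀ s →
                         ∃[ L ] (∀ {x} → Continuation bs s x → x ∈ L)
  continuations-finite {bs} (bar next) s with em {Any (_⊑ˢ s) bs}
  ... | yes ⊑s = s ∷ [] , λ
    { halt          → here refl
    ; (step ¬⊑ _ _) → contradiction ⊑s ¬⊑ }
  ... | no ¬⊑s = s ∷ concatMap (proj₁ ∘ rec) ts , λ
    { halt         → here refl
    ; (step _ t c) → there (∈-concatMap⁺ (proj₁ ∘ rec) (lose (ts-complete t) (proj₂ (rec t) c))) }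
    where
    rec : ∀ t → ∃[ L ] (∀ {x} → Continuation (s ∷ bs) (postˢ s t) x → x ∈ L)
    rec t = continuations-finite (next s ¬⊑s) (postˢ s t)

  opaque
    runs-finite : ∃[ L ] (∀ {bs x} → Run bs x → x ∈ L)
    runs-finite =
      let L , complete = continuations-finite (bar-[] em _⊑ˢ_ ⊑-good) s₀ˢ
      in L , λ r → complete (Run⇒Continuation r halt)

  _≈ˢ_ : S → S → Set
  (s , _) ≈ˢ (s′ , _) = s ≈ᴺ s′

  -- Each node before the last passed the domination test when it was extended. As `≈ᴺ` entails `⊑`,
  -- it repeats none of its predecessors.
  Run-prefix : ∀ {bs x y} → Run bs x → ¬ Any (_≈ˢ x) bs → y ∈ x ∷ bs →
               ∃[ bs′ ] (Run bs′ y × ¬ Any (_≈ˢ y) bs′ × bs′ ⊆ bs)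
  Run-prefix r fresh (here refl) = _ , r , fresh , id
  Run-prefix (step r ¬⊑ t) _ (there y∈) =
    let bs′ , r′ , fresh′ , ⊆bs = Run-prefix r (¬⊑ ∘ Any.map ≈ᴺ⇒⊑) y∈
    in bs′ , r′ , fresh′ , there ∘ ⊆bs

  Run-start : ∀ {b bs x} → Run (b ∷ bs) x → s₀ˢ ∈ b ∷ bs
  Run-start (step begin _ _)           = here refl
  Run-start (step r@(step _ _ _) _ _) = there (Run-start r)

  ⊑⇒⊏⊎≈ : ∀ {s s′ : Node P V} → s ⊑ s′ → s ⊏ s′ ⊎ s ≈ᴺ s′
  ⊑⇒⊏⊎≈ {M , _} {M′ , _} (a , le) with decide em (∃[ p ] M p ℕ.< M′ p)
  ... | yes M<M′ = inj₁ (a , le , M<M′)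
  ... | no  M≮M′ = inj₂ ((λ p → ℕ.≤-antisym (le p) (ℕ.≮⇒≥ λ h → M≮M′ (p , h))) , a)

  -- Induction on the branch; when the new node repeats one on the run, the run is cut back to that
  -- occurrence. Since the earlier nodes of the run all occur on the branch, a strictly smaller one
  -- contradicts liveness, while an equal one contradicts the absence of repetitions.
  prune : ∀ {before s} → Branch N s₀ before s →
    ∃[ bs ] ∃[ x ] (Run bs x × proj₁ x ≈ᴺ s × ¬ Any (_≈ˢ x) bs ×
                    All (λ b → Any (proj₁ b ≈ᴺ_) before) bs)
  prune (root e) = [] , s₀ˢ , begin , ≈ᴺ-sym e , (λ ()) , []
  prune (extend {before} {s} {t} {s′} br live arc) with prune br
  ... | bs , x , r , x≈s , fresh , visited = result
    where
    unblocked : LiveAt N s₀ before s ⊎ s ≈ᴺ s₀ → ∀ {bs} → Run bs x → ¬ Any (_≈ˢ x) bs →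
                All (λ b → Any (proj₁ b ≈ᴺ_) before) bs → ¬ Any (_⊑ˢ x) bs
    unblocked (inj₁ live) r fresh visited ⊑x with find ⊑x
    ... | b , b∈ , b⊑x with ⊑⇒⊏⊎≈ b⊑x
    ...   | inj₂ b≈x = fresh (lose b∈ b≈x)
    ...   | inj₁ b⊏x = live (inj₂ (Any.map (λ e → ⊏-resp-≈ᴺ e x≈s b⊏x) (All.lookup visited b∈)))
    -- The initial node may be expanded without being live, but a nonempty run ending in a node
    -- equal to it would repeat its own start.
    unblocked (inj₂ s≈s₀) {_ ∷ _} r fresh _ _ =
      fresh (lose (Run-start r) (≈ᴺ-sym (≈ᴺ-trans x≈s s≈s₀)))
    y : S
    y = postˢ x t
    r′ : Run (x ∷ bs) y
    r′ = step r (unblocked live r fresh visited) t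
    y≈s′ : proj₁ y ≈ᴺ s′
    y≈s′ = ≈ᴺ-sym (Arc⇒≈post N (Arc-resp N (≈ᴺ-sym x≈s) ≈ᴺ-refl arc))
    visited′ : All (λ b → Any (proj₁ b ≈ᴺ_) (s ∷ before)) (x ∷ bs)
    visited′ = here x≈s ∷ All.map there visited
    result : ∃[ bs ] ∃[ x ] (Run bs x × proj₁ x ≈ᴺ s′ × ¬ Any (_≈ˢ x) bs ×
                             All (λ b → Any (proj₁ b ≈ᴺ_) (s ∷ before)) bs)
    result with em {Any (_≈ˢ y) (x ∷ bs)}
    ... | no ¬repeat = x ∷ bs , y , r′ , y≈s′ , ¬repeat , visited′
    ... | yes repeat with find repeat
    ...   | z , z∈ , z≈y with Run-prefix r fresh z∈
    ...   | bs′ , r″ , fresh′ , ⊆bs =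
      bs′ , z , r″ , ≈ᴺ-trans z≈y y≈s′ , fresh′ , All.tabulate (All.lookup visited′ ∘ there ∘ ⊆bs)

  -- Assembling the colored graph

  nodeDecSetoid : DecSetoid _ _
  nodeDecSetoid = record
    { Carrier = Node P V
    ; _≈_ = _≈ᴺ_
    ; isDecEquivalence = record
      { isEquivalence = record { refl = ≈ᴺ-refl ; sym = ≈ᴺ-sym ; trans = ≈ᴺ-trans }
      ; _≟_ = λ s s′ → decide em (s ≈ᴺ s′) } }

  open DecSetoid nodeDecSetoid using (_≟_)

  isCGNode? : (s : Node P V) → Dec (CGNode N s₀ s)
  isCGNode? _ = em

  lookup-distinct : ∀ {xs : List (Node P V)} → AllPairs (λ s s′ → ¬ s ≈ᴺ s′) xs →
                    ∀ i j → lookup xs i ≈ᴺ lookup xs j → i ≡ j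
  lookup-distinct (_ ∷ _) zero zero _ = refl
  lookup-distinct (d ∷ _) zero (suc j) e = contradiction e (All.lookup d (∈-lookup j))
  lookup-distinct (d ∷ _) (suc i) zero e = contradiction (≈ᴺ-sym e) (All.lookup d (∈-lookup i))
  lookup-distinct (_ ∷ ds) (suc i) (suc j) e = cong suc (lookup-distinct ds i j e)

  opaque
    found nodes : List (Node P V)
    found = filter isCGNode? (map proj₁ (proj₁ runs-finite))
    nodes = deduplicate _≟_ found

    nodes-sound : All (CGNode N s₀) nodes
    nodes-sound = All.deduplicate⁺ _≟_ (All.all-filter isCGNode? (map proj₁ (proj₁ runs-finite)))

    nodes-complete : ∀ {s} → CGNode N s₀ s → Any (s ≈ᴺ_) nodes
    nodes-complete (before , br) with prune br
    ... | bs , x , r , x≈s , _ =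
      Any.deduplicate⁺ _≟_ (λ e h → ≈ᴺ-trans h (≈ᴺ-sym e))
        (lose (∈-filter⁺ isCGNode? (∈-map⁺ proj₁ (proj₂ runs-finite r))
                (before , Branch-resp N s₀ (≈ᴺ-sym x≈s) br))
              (≈ᴺ-sym x≈s))

    nodes-distinct : AllPairs (λ s s′ → ¬ s ≈ᴺ s′) nodes
    nodes-distinct = deduplicate-! nodeDecSetoid found

  Index : Set
  Index = Fin (length nodes)

  nodeAt : Index → Node P V
  nodeAt = lookup nodes

  nodeAt-sound : ∀ i → CGNode N s₀ (nodeAt i)
  nodeAt-sound i = All.lookup nodes-sound (∈-lookup i)

  nodeAt-complete : ∀ s → CGNode N s₀ s → ∃[ i ] s ≈ᴺ nodeAt i
  nodeAt-complete s cg = Any.index (nodes-complete cg) , Any.lookup-index (nodes-complete cg)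

  isCGArc? : ((i , t , j) : Index × T × Index) → Dec (CGArc N s₀ (nodeAt i) t (nodeAt j))
  isCGArc? _ = em

  triples : List (Index × T × Index)
  triples = cartesianProduct (allFin _) (cartesianProduct ts (allFin _))

  opaque
    definingConstraint : ∀ i → ∃[ φ ] (φ ∈ candidates × (∀ α → α ⊨ φ ⇔ proj₂ (nodeAt i) α))
    definingConstraint i =
      invariant⇒definable (proj₂ (nodeAt i)) (Branch-invariant (proj₂ (nodeAt-sound i)))

  colored : ∀ {A : Set₁} → Dec A → ∃[ c ] (c ≡ green ⇔ A)
  colored (yes a) = green , mk⇔ (const a) (const refl)
  colored (no ¬a) = red , mk⇔ (λ ()) (λ a → contradiction a ¬a)

  CCG-exists : ∀ M-F → CCG N M₀ α₀ M-F
  CCG-exists M-F = record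
    { size          = length nodes
    ; node          = nodeAt
    ; node-sound    = nodeAt-sound
    ; node-complete = nodeAt-complete
    ; node-distinct = lookup-distinct nodes-distinct
    ; start         = proj₁ start
    ; start-initial = ≈ᴺ-sym (proj₂ start)
    ; arcs          = filter isCGArc? triples
    ; arcs-correct  = λ i t j → mk⇔ (λ a∈ → proj₂ (∈-filter⁻ isCGArc? {xs = triples} a∈))
        (∈-filter⁺ isCGArc? (∈-cartesianProduct⁺ (∈-allFin i)
                              (∈-cartesianProduct⁺ (ts-complete t) (∈-allFin j))))
    ; constraint    = λ i → proj₁ (definingConstraint i)
    ; represents    = λ i → proj₂ (proj₂ (definingConstraint i))
    ; color         = λ i → proj₁ (colored (em {Green N s₀ M-F (nodeAt i)}))
    ; color-correct = λ i → proj₂ (colored (em {Green N s₀ M-F (nodeAt i)}))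
    }
    where
    start : ∃[ i ] s₀ ≈ᴺ nodeAt i
    start = nodeAt-complete s₀ ([] , root ≈ᴺ-refl)

-- Critical arcs

red≢green : ∀ {c} → c ≡ red → c ≡ green → ⊥
red≢green refl ()

module Paths (em : ExcludedMiddle (Level.suc 0ℓ)) {P V : ℕ} {T : Set} {N : Net P V T}
  {M₀ : Marking P} {α₀ : Valuation V} {M-F : Marking P} (G : CCG N M₀ α₀ M-F) where

  open CCG G

  s₀ : Node P V
  s₀ = initialNode M₀ α₀

  Branch⇒PathTo : ∀ {before s} → Branch N s₀ before s → ∀ i → s ≈ᴺ node i → PathTo i
  Branch⇒PathTo (root e) i s≈i =
    subst PathTo (node-distinct start i
      (≈ᴺ-trans start-initial (≈ᴺ-trans (≈ᴺ-sym e) s≈i))) here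
  Branch⇒PathTo (extend {before} {s} {t} br live arc) i s′≈i
    with node-complete s (before , br)
  ... | k , s≈k = Branch⇒PathTo br k s≈k ▷
    from (arcs-correct k t i) (CGArc-resp N s₀ s≈k s′≈i (before , br , live , arc))

  pathTo : ∀ i → PathTo i
  pathTo i = Branch⇒PathTo (proj₂ (node-sound i)) i ≈ᴺ-refl

  cut : ∀ {i j} (π : PathTo i) → Simple π → j ∈ visited π → Σ (PathTo j) Simple
  cut here      s       (here refl) = here , s
  cut (π ▷ a∈)  s       (here refl) = π ▷ a∈ , s
  cut (π ▷ _)   (_ ∷ s) (there j∈)  = cut π s j∈

  simplePath : ∀ {i} → PathTo i → Σ (PathTo i) Simple
  simplePath here = here , [] ∷ []
  simplePath (_▷_ {j = j} π a∈) with simplePath π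
  ... | π′ , s with decide em (j ∈ visited π′)
  ...   | yes j∈ = cut π′ s j∈
  ...   | no  j∉ = π′ ▷ a∈ , All.¬Any⇒All¬ _ j∉ ∷ s

  green-source : ∀ {i t j} → (i , t , j) ∈ arcs → color j ≡ green → color i ≡ green
  green-source a∈ g = from (color-correct _)
    (via (to (arcs-correct _ _ _) a∈) (to (color-correct _) g))

  green-start : ∀ {i} → PathTo i → color i ≡ green → color start ≡ green
  green-start here     g = g
  green-start (π ▷ a∈) g = green-start π (green-source a∈ g)

  green-to-red : ∀ {i} → PathTo i → color start ≡ green → color i ≡ red →
                 ∃[ a ] (a ∈ arcs × Critical a)
  green-to-red here g r = ⊥-elim (red≢green r g)
  green-to-red (_▷_ {i = i} π a∈) g r with color i in c
  ... | red   = green-to-red π g c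
  ... | green = _ , a∈ , c , r

  -- A green node makes the start green, since it is reachable from there; on a path from the start
  -- to a red node the color must then change at some arc.
  critical-exists : Mixed G → ∃[ a ] (a ∈ arcs × Critical a)
  critical-exists ((i , g) , (j , r)) = green-to-red (pathTo j) (green-start (pathTo i) g) r

  arc : ∀ {i t j} → (i , t , j) ∈ arcs → Arc N (node i) t (node j)
  arc a∈ = let _ , _ , _ , a = to (arcs-correct _ _ _) a∈ in a

⊨-resp-≈ : ExcludedMiddle (Level.suc 0ℓ) → ∀ {X : Set} {θ θ′ : X → ℝ} (φ : Φ X) →
           (∀ x → θ x ≈ᴿ θ′ x) → θ ⊨ φ → θ′ ⊨ φ
⊨-resp-≈ em φ e = constants⊆⇒invariant φ id (≈⇒∼ em e)
  where open OrderType (constants φ)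

module _ (em : ExcludedMiddle (Level.suc 0ℓ)) {P V : ℕ} {T : Set} (N : Net P V T) where

  -- The added constraint reads an unwritten variable before the firing, where the frame condition
  -- gives it the same value as after.
  after-⊨ : ∀ u φ {α α′ : Valuation V} → (∀ v → ¬ Writes N u v → α′ v ≈ᴿ α v) →
            α′ ⊨ φ → [ α , α′ ]′ ⊨ rename (after N u) φ
  after-⊨ u φ {α} {α′} frame h = from (⊨-rename (after N u) φ) (⊨-resp-≈ em φ value h)
    where
    value : ∀ v → α′ v ≈ᴿ [ α , α′ ]′ (after N u v)
    value v with writes? N u v
    ... | yes _  = λ _ → refl
    ... | no  ¬w = frame v ¬w

rename-ʳ-no-writes : ∀ {V} (φ : Φ (Fin V)) v → ¬ Occurs (v ʷ) (rename {Y = IOVar V} _ʳ φ)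
rename-ʳ-no-writes (cmpV _ _ _) v (inj₁ ())
rename-ʳ-no-writes (cmpV _ _ _) v (inj₂ ())
rename-ʳ-no-writes (cmpC _ _ _) v ()
rename-ʳ-no-writes (¬̇ φ)        v o        = rename-ʳ-no-writes φ v o
rename-ʳ-no-writes (φ ∧ ψ)      v (inj₁ o) = rename-ʳ-no-writes φ v o
rename-ʳ-no-writes (φ ∧ ψ)      v (inj₂ o) = rename-ʳ-no-writes ψ v o

module CriticalArcs (em : ExcludedMiddle (Level.suc 0ℓ)) {P V : ℕ} {T : Set}
  (N : Net P V T) (cond : T → Φ (Fin V))
  {M₀ : Marking P} {α₀ : Valuation V} {M-F : Marking P}
  (G : CCG (τ-DPN N cond) M₀ α₀ M-F) where

  open CCG G
  open Paths em G

  Nτ : Net P V (T ⊎ τIndex N)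
  Nτ = τ-DPN N cond

  valuations : Fin size → Valuation V → Set
  valuations i = proj₂ (node i)

  valuations-resp : ∀ i {α α′ : Valuation V} → (∀ v → α v ≈ᴿ α′ v) →
                    valuations i α → valuations i α′
  valuations-resp i e h = to (represents i _) (⊨-resp-≈ em (constraint i) e (from (represents i _) h))

  -- A τ-guard writes no variable, so the frame condition equates each valuation after the arc with
  -- one before it.
  τ-shrinks : ∀ {i τ j} → (i , inj₂ τ , j) ∈ arcs → ∀ {α} → valuations j α → valuations i α
  τ-shrinks {i} {τ} {j} a∈ h with arc a∈
  ... | _ , _ , (image , _) , _ with image h
  ... | α , α∈ , _ , _ , _ , frame =
    valuations-resp i (λ v q → sym (frame v (rename-ʳ-no-writes (cond (proj₁ τ)) v) q)) α∈

  τ-marking : ∀ {i τ j} → (i , inj₂ τ , j) ∈ arcs → ∀ p → proj₁ (node j) p ≡ proj₁ (node i) p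
  τ-marking a∈ p with arc a∈
  ... | en , up , _ = trans (up p) (ℕ.m∸n+n≡m (en p))

  -- The only valuation at the initial node cannot be shrunk away.
  τ-start : ∀ {τ j} → (start , inj₂ τ , j) ∈ arcs → j ≡ start
  τ-start {τ} {j} a∈ with arc a∈ | start-initial
  ... | _ , _ , _ , α′ , α′∈ | _ , ⊆α₀ , _ =
    node-distinct j start (τ-marking a∈ , τ-shrinks a∈ , λ {β} β∈ →
      valuations-resp j (λ v q → trans (⊆α₀ (τ-shrinks a∈ α′∈) v q) (sym (⊆α₀ β∈ v q))) α′∈)

  -- A property of the node rather than of an arc, so that it passes along τ-arcs, which only
  -- discard valuations.
  ResultOf : T → Fin size → Set
  ResultOf u i = ∀ {α′} → valuations i α′ →
    ∃[ α ] ([ α , α′ ]′ ⊨ guard N u × (∀ v → ¬ Writes N u v → α′ v ≈ᴿ α v))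

  arc-result : ∀ {i u j} → (i , inj₁ u , j) ∈ arcs → ResultOf u j
  arc-result a∈ h with arc a∈
  ... | _ , _ , (image , _) , _ = let α , _ , _ , _ , g , frame = image h in α , g , frame

  -- τ-arcs alone never leave the start, so a path ending elsewhere has a last non-τ arc, and its
  -- effect survives the τ-arcs after it.
  lastNonτ-result : ∀ {i} (π : PathTo i) →
    i ≡ start ⊎ (∃[ u ] (lastNonτ isτ π ≡ just (inj₁ u) × ResultOf u i))
  lastNonτ-result here = inj₁ refl
  lastNonτ-result (_▷_ {t = inj₁ u} π a∈) = inj₂ (u , refl , arc-result a∈)
  lastNonτ-result (_▷_ {t = inj₂ τ} π a∈) with lastNonτ-result π
  ... | inj₁ refl          = inj₁ (τ-start a∈)
  ... | inj₂ (u , e , res) = inj₂ (u , e , res ∘ τ-shrinks a∈)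

  inhabited-at : ∀ {i t j} → (i , t , j) ∈ arcs → ∃ (valuations j)
  inhabited-at a∈ = let _ , _ , _ , h = arc a∈ in h

  ResultOf-satisfies : ∀ {u i j} → ResultOf u i → ∀ {α′} → valuations i α′ → valuations j α′ →
    ∃[ θ ] (θ ⊨ guard N u × θ ⊨ rename (after Nτ (inj₁ u)) (constraint j))
  ResultOf-satisfies {u} {i} {j} res {α′} h h′ =
    let α , g , frame = res h in
    [ α , α′ ]′ , g , after-⊨ em Nτ (inj₁ u) (constraint j) frame (from (represents j α′) h′)

  -- Supplies an assignment that the old guard admits and the added conjunct rules out, which is
  -- what makes the measure drop.
  critical-restricts : ∀ {a} → a ∈ arcs → Critical a →
    ∃[ u ] (Restricts isτ a (inj₁ u) ×
            ∃[ θ ] (θ ⊨ guard N u × θ ⊨ rename (after Nτ (inj₁ u)) (constraint (proj₂ (proj₂ a)))))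
  critical-restricts {i , inj₁ u , j} a∈ _ = let α′ , h = inhabited-at a∈ in
    u , inj₁ (refl , refl) , ResultOf-satisfies {j = j} (arc-result a∈) h h
  critical-restricts {i , inj₂ τ , j} a∈ (gi , rj) with simplePath (pathTo i)
  ... | π , simple with lastNonτ-result π
  -- The critical arc would be a loop at the start, with a source and a target of the same color.
  ...   | inj₁ refl = ⊥-elim (red≢green rj (trans (cong color (τ-start a∈)) gi))
  -- A valuation at the red target also occurs at the source of the τ-arc, where it results from
  -- `u`.
  ...   | inj₂ (u , e , res) = let α′ , h = inhabited-at a∈ in
    u , inj₂ (refl , π , simple , e) , ResultOf-satisfies {j = j} res (τ-shrinks a∈ h) h

-- Repaired guards

module _ {X A : Set} {χ : A → Φ X} where

  foldl-∧ : ∀ as φ (θ : X → ℝ) →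
            θ ⊨ foldl (λ ψ a → ψ ∧ χ a) φ as ⇔ (θ ⊨ φ × All (λ a → θ ⊨ χ a) as)
  foldl-∧ [] φ θ = mk⇔ (_, []) proj₁
  foldl-∧ (a ∷ as) φ θ = mk⇔
    (λ h → let (p , q) , r = to (foldl-∧ as (φ ∧ χ a) θ) h in p , q ∷ r)
    (λ { (p , q ∷ r) → from (foldl-∧ as (φ ∧ χ a) θ) ((p , q) , r) })

module Repair (em : ExcludedMiddle (Level.suc 0ℓ)) {P V : ℕ} {T : Set} (N : Net P V T)
  {M₀ : Marking P} {α₀ : Valuation V} {M-F : Marking P} (isτ : T → Bool) (G : CCG N M₀ α₀ M-F)
  where

  open CCG G

  repaired : T → Φ (IOVar V)
  repaired = guard (MakeRepairStep em N isτ G)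

  excluded : T → Fin size × T × Fin size → Φ (IOVar V)
  excluded u a = ¬̇ rename (after N u) (constraint (proj₂ (proj₂ a)))

  restricts? : ∀ u (a : Fin size × T × Fin size) → Dec (Critical a × Restricts isτ a u)
  restricts? u a = decide em _

  ⊨-repaired : ∀ u {θ} → θ ⊨ repaired u ⇔
    (θ ⊨ guard N u × All (λ a → θ ⊨ excluded u a) (filter (restricts? u) arcs))
  ⊨-repaired u {θ} = foldl-∧ {χ = excluded u} (filter (restricts? u) arcs) (guard N u) θ

  repaired⇒guard : ∀ u {θ} → θ ⊨ repaired u → θ ⊨ guard N u
  repaired⇒guard u = proj₁ ∘ to (⊨-repaired u)

  repaired-excludes : ∀ u {a θ} → a ∈ arcs → Critical a → Restricts isτ a u →
                      θ ⊨ repaired u → θ ⊨ excluded u a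
  repaired-excludes u a∈ c r h =
    All.lookup (proj₂ (to (⊨-repaired u) h)) (∈-filter⁺ (restricts? u) a∈ (c , r))

  module _ {C : List ℝ} where
    open OrderType C

    -- The formula chosen to represent a node may mention constants outside `C`; its invariance
    -- depends only on the set it represents.
    repaired-invariant : (∀ i → Invariant (proj₂ (node i))) →
                         (∀ u → InvariantΦ (guard N u)) → ∀ u → InvariantΦ (repaired u)
    repaired-invariant nodes guards u {θ} {θ′} e h =
      from (⊨-repaired u) (guards u e (proj₁ parts) , All.map (λ {a} → keeps a) (proj₂ parts))
      where
      parts : θ ⊨ guard N u × All (λ a → θ ⊨ excluded u a) (filter (restricts? u) arcs)
      parts = to (⊨-repaired u) h
      keeps : ∀ a → θ ⊨ excluded u a → θ′ ⊨ excluded u a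
      keeps (_ , _ , j) = invariant-¬ (rename (after N u) (constraint j))
        (invariant-rename (after N u) (constraint j)
          (invariant-⇔ (λ α → mk⇔ (from (represents j α)) (to (represents j α))) (nodes j))) e

-- The number of order types satisfying a guard

module Counting {X : Set} (_⊨?_ : (θ : X → ℝ) (φ : Φ X) → Dec (θ ⊨ φ)) where

  #sat : List (X → ℝ) → Φ X → ℕ
  #sat R φ = length (filter (_⊨? φ) R)

  #sat-pos : ∀ {R r} φ → r ∈ R → r ⊨ φ → 0 ℕ.< #sat R φ
  #sat-pos φ r∈ h = List.filter-some (_⊨? φ) (lose r∈ h)

  #sat-mono : ∀ R {φ ψ} → (∀ {θ} → θ ⊨ φ → θ ⊨ ψ) → #sat R φ ℕ.≤ #sat R ψ
  #sat-mono [] _ = z≤n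
  #sat-mono (r ∷ R) {φ} {ψ} φ⇒ψ with r ⊨? φ | r ⊨? ψ
  ... | yes _ | yes _ = s≤s (#sat-mono R {φ} {ψ} φ⇒ψ)
  ... | yes p | no ¬q = contradiction (φ⇒ψ p) ¬q
  ... | no _  | yes _ = ℕ.m≤n⇒m≤1+n (#sat-mono R {φ} {ψ} φ⇒ψ)
  ... | no _  | no _  = #sat-mono R {φ} {ψ} φ⇒ψ

  #sat-split : ∀ R φ ψ → #sat R (φ ∧ ¬̇ ψ) + #sat R (φ ∧ ψ) ≡ #sat R φ
  #sat-split [] φ ψ = refl
  #sat-split (r ∷ R) φ ψ
    with r ⊨? (φ ∧ ¬̇ ψ) | r ⊨? (φ ∧ ψ) | r ⊨? φ | r ⊨? ψ
  ... | yes (_ , ¬q) | yes (_ , q) | _     | _     = contradiction q ¬q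
  ... | yes _        | no _        | yes _ | _     = cong suc (#sat-split R φ ψ)
  ... | no _         | yes _       | yes _ | _     =
    trans (ℕ.+-suc _ _) (cong suc (#sat-split R φ ψ))
  ... | no _         | no _        | no _  | _     = #sat-split R φ ψ
  ... | no _         | no ¬pq      | yes p | yes q = contradiction (p , q) ¬pq
  ... | no ¬pq       | no _        | yes p | no ¬q = contradiction (p , ¬q) ¬pq
  ... | yes (p , _)  | _           | no ¬p | _     = contradiction p ¬p
  ... | _            | yes (p , _) | no ¬p | _     = contradiction p ¬p

  -- Splitting `ψ` by `φ` leaves a part outside `φ` that contains `r`, and a part inside `φ` that
  -- counts at least as much as `φ`.
  #sat-strict : ∀ {R r} {φ ψ : Φ X} → (∀ {θ} → θ ⊨ φ → θ ⊨ ψ) →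
                 r ∈ R → r ⊨ ψ → ¬ r ⊨ φ → #sat R φ ℕ.< #sat R ψ
  #sat-strict {R} {_} {φ} {ψ} φ⇒ψ r∈ q ¬p = subst (#sat R φ ℕ.<_) (#sat-split R ψ φ)
    (ℕ.+-mono-<-≤ (#sat-pos (ψ ∧ ¬̇ φ) r∈ (q , ¬p))
                  (#sat-mono R {φ} {ψ ∧ φ} λ p → φ⇒ψ p , p))

-- Shifted so that splitting k into two positive parts lowers the total, while strict monotonicity
-- is kept.
weight : ℕ → ℕ
weight k = 2 * k ∸ 1

weight-suc : ∀ k → weight (suc k) ≡ suc (2 * k)
weight-suc k = ℕ.+-suc k (k + 0)

weight-mono : ∀ {j k} → j ℕ.≤ k → weight j ℕ.≤ weight k
weight-mono j≤k = ℕ.∸-monoˡ-≤ 1 (ℕ.*-monoʳ-≤ 2 j≤k)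

weight-strict : ∀ {j k} → j ℕ.< k → weight j ℕ.< weight k
weight-strict {j} {suc k} (s≤s j≤k) = subst (weight j ℕ.<_) (sym (weight-suc k))
  (s≤s (ℕ.≤-trans (ℕ.m∸n≤m (2 * j) 1) (ℕ.*-monoʳ-≤ 2 j≤k)))

double-suc : ∀ a b → 2 + (2 * a + (1 + 2 * b)) ≡ 1 + 2 * (a + (1 + b))
double-suc = solve-∀

-- For positive `a` and `b`, (2a - 1) + (2b - 1) is one less than 2(a + b) - 1.
weight-split : ∀ {a b} → 0 ℕ.< a → 0 ℕ.< b → weight a + weight b ℕ.< weight (a + b)
weight-split {suc a} {suc b} _ _
  rewrite weight-suc a | weight-suc b | weight-suc (a + suc b) = ℕ.≤-reflexive (double-suc a b)
sum-mono : ∀ {n} {f g : Fin n → ℕ} → (∀ i → f i ℕ.≤ g i) → sum f ℕ.≤ sum g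
sum-mono {zero}  _   = z≤n
sum-mono {suc n} f≤g = ℕ.+-mono-≤ (f≤g zero) (sum-mono (f≤g ∘ suc))

-- The summand `e` accounts for the additional transition created by a split; a repair step uses it
-- with `e` equal to 0.
sum-decrease : ∀ {n} (f g : Fin n → ℕ) i e → (∀ j → j ≢ i → f j ℕ.≤ g j) →
               e + f i ℕ.< g i → e + sum f ℕ.< sum g
sum-decrease f g zero e f≤g lt′ = subst (ℕ._< sum g) (ℕ.+-assoc e (f zero) _)
  (ℕ.+-mono-<-≤ lt′ (sum-mono λ j → f≤g (suc j) λ ()))
sum-decrease {suc n} f g (suc i) e f≤g lt′ = subst (ℕ._< sum g) (x∙yz≈y∙xz (f zero) e _)
  (ℕ.+-mono-≤-< (f≤g zero λ ()) (sum-decrease (f ∘ suc) (g ∘ suc) i e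
    (λ j j≢i → f≤g (suc j) (j≢i ∘ Fin.suc-injective)) lt′))

-- Termination

enumerateTrue : ∀ {A : Set} (a? : Dec A) → List (True a?)
enumerateTrue (yes _) = tt ∷ []
enumerateTrue (no _)  = []

enumerateTrue-complete : ∀ {A : Set} (a? : Dec A) x → x ∈ enumerateTrue a?
enumerateTrue-complete (yes _) tt = here refl

τTransitions : ∀ {P V n} (N : DPN P n V) → List (Fin n ⊎ τIndex N)
τTransitions {n = n} N = map inj₁ (allFin n) ++
  map inj₂ (concatMap (λ t → map (t ,_) (enumerateTrue (hasInput? N t))) (allFin n))

τTransitions-complete : ∀ {P V n} (N : DPN P n V) t → t ∈ τTransitions N
τTransitions-complete N (inj₁ t) = ∈-++⁺ˡ (∈-map⁺ inj₁ (∈-allFin t))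
τTransitions-complete N (inj₂ (t , h)) = ∈-++⁺ʳ _ (∈-map⁺ inj₂ (∈-concatMap⁺ _
  (lose (∈-allFin t) (∈-map⁺ (t ,_) (enumerateTrue-complete (hasInput? N t) h)))))

module Termination (em : ExcludedMiddle (Level.suc 0ℓ)) {P T V : ℕ} (N : DPN P T V)
                   (M-I : Marking P) (α-I : Valuation V) (M-F : Marking P) where

  open RepairDPN em N M-I α-I M-F

  -- Fixed once from the source net and the initial valuation. Later guards may acquire other
  -- constants, but remain invariant with respect to this `C`, so a single list of representatives
  -- serves the whole execution.
  C : List ℝ
  C = concatMap (constants ∘ guard N) (allFin T) ++ map α-I (allFin V)

  α-I∈C : ∀ v → α-I v ∈ C
  α-I∈C v = ∈-++⁺ʳ (concatMap (constants ∘ guard N) (allFin T)) (∈-map⁺ α-I (∈-allFin v))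

  constants⊆C : ∀ t → constants (guard N t) ⊆ C
  constants⊆C t c∈ = ∈-++⁺ˡ (∈-concatMap⁺ (constants ∘ guard N) (lose (∈-allFin t) c∈))

  open OrderType C

  ioVariables : List (IOVar V)
  ioVariables = map inj₁ (allFin V) ++ map inj₂ (allFin V)

  ioVariables-complete : ∀ x → x ∈ ioVariables
  ioVariables-complete (inj₁ v) = ∈-++⁺ˡ (∈-map⁺ inj₁ (∈-allFin v))
  ioVariables-complete (inj₂ v) = ∈-++⁺ʳ (map inj₁ (allFin V)) (∈-map⁺ inj₂ (∈-allFin v))

  module IO = Definability em C ioVariables-complete
  module Value = Definability em C {xs = allFin V} ∈-allFin

  InvariantGuards : ∀ {T : Set} → Net P V T → Set
  InvariantGuards N = ∀ t → InvariantΦ (guard N t)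

  inputCondition-invariant : ∀ {T : Set} (N : Net P V T) → InvariantGuards N →
    ∀ t φ → IsInputCondition N t φ → InvariantΦ φ
  inputCondition-invariant N inv t φ ic =
    invariant-⇔ (λ α → mk⇔ (from (ic α)) (to (ic α))) (invariant-∃ em (inv t))

  -- Quantifier elimination obtained semantically: the projection of an invariant set is invariant,
  -- hence definable.
  inputConditions-exist : ∀ {T : Set} (N : Net P V T) → InvariantGuards N →
    Σ (T → Φ (Fin V)) λ cond → ∀ t → IsInputCondition N t (cond t)
  inputConditions-exist N inv = (λ t → proj₁ (φ t)) , λ t → proj₂ (proj₂ (φ t))
    where
    φ : ∀ t → ∃[ φ ] (φ ∈ Value.candidates × IsInputCondition N t φ)
    φ t = Value.invariant⇒definable _ (invariant-∃ em (inv t))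

  τ-invariant : ∀ {T : Set} (N : Net P V T) → InvariantGuards N →
    ∀ cond → (∀ t → IsInputCondition N t (cond t)) → InvariantGuards (τ-DPN N cond)
  τ-invariant N inv cond ic (inj₁ t) = inv t
  τ-invariant N inv cond ic (inj₂ (t , _)) = invariant-¬ (rename _ʳ (cond t))
    (invariant-rename _ʳ (cond t) (inputCondition-invariant N inv t (cond t) (ic t)))

  repair-invariant : ∀ {T : Set} {ts : List T} → (∀ t → t ∈ ts) → ∀ (N : Net P V T) →
    InvariantGuards N → ∀ isτ (G : CCG N M-I α-I M-F) → InvariantGuards (MakeRepairStep em N isτ G)
  repair-invariant ts-complete N inv isτ G = Repair.repaired-invariant em N isτ G
    (λ i → CoverabilityGraph.Branch-invariant em C ts-complete N inv M-I α-I α-I∈C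
             (proj₂ (CCG.node-sound G i)))
    inv

  -- The measure and its decrease

  open Counting {IOVar V} (λ θ φ → decide em (θ ⊨ φ))

  load : Φ (IOVar V) → ℕ
  load φ = weight (#sat IO.representatives φ)

  size : ∀ {n} → DPN P n V → ℕ
  size N = sum (load ∘ guard N)

  split-invariant : ∀ {W W′ : WorkNet P T V} → InvariantGuards (net W) → Splits M-I α-I W W′ →
                    InvariantGuards (net W′)
  split-invariant {W} inv (splits _ {t} {tₒᵤₜ} {φ} _ _ _ ic _ _) = λ
    { zero    → invariant-∧ (guard (net W) t) (¬̇ φ′) (inv t) (invariant-¬ φ′ φ′-invariant)
    ; (suc u) → positive u }
    where
    φ′ : Φ (IOVar V)
    φ′ = rename (after (net W) t) φ
    φ′-invariant : InvariantΦ φ′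
    φ′-invariant = invariant-rename (after (net W) t) φ
      (inputCondition-invariant (net W) inv tₒᵤₜ φ ic)
    positive : ∀ u → InvariantΦ (guard (net (splitAt W t φ)) (suc u))
    positive u with u Fin.≟ t
    ... | yes _ = invariant-∧ (guard (net W) t) φ′ (inv t) φ′-invariant
    ... | no _  = inv u

  satisfiable⇒#sat-pos : ∀ φ → InvariantΦ φ → Satisfiable φ →
                          0 ℕ.< #sat IO.representatives φ
  satisfiable⇒#sat-pos φ inv (θ , h) =
    let r , r∈ , r∼θ = IO.representative θ in #sat-pos φ r∈ (inv (∼-sym r∼θ) h)

  split-decreases : ∀ {W W′ : WorkNet P T V} → InvariantGuards (net W) → Splits M-I α-I W W′ →
                    size (net W′) ℕ.< size (net W)
  split-decreases {W} inv (splits _ {t} {tₒᵤₜ} {φ} _ _ _ ic sat⁺ sat⁻) =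
    -- Index `zero` holds the negative half and becomes the extra summand; `suc t` holds the
    -- positive half. Both halves are satisfiable by the premises of `splits`, hence both counts are
    -- positive.
    sum-decrease (load ∘ guard (net (splitAt W t φ)) ∘ suc) (load ∘ guard (net W)) t _ other this
    where
    γ φ′ : Φ (IOVar V)
    γ  = guard (net W) t
    φ′ = rename (after (net W) t) φ
    φ′-invariant : InvariantΦ φ′
    φ′-invariant = invariant-rename (after (net W) t) φ
      (inputCondition-invariant (net W) inv tₒᵤₜ φ ic)
    other : ∀ u → u ≢ t → load (guard (net (splitAt W t φ)) (suc u)) ℕ.≤ load (guard (net W) u)
    other u u≢t with u Fin.≟ t
    ... | yes u≡t = contradiction u≡t u≢t
    ... | no _    = ℕ.≤-refl
    this : load (γ ∧ ¬̇ φ′) + load (guard (net (splitAt W t φ)) (suc t)) ℕ.< load γ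
    this with t Fin.≟ t
    ... | no t≢t = contradiction refl t≢t
    ... | yes _  = subst (λ k → load (γ ∧ ¬̇ φ′) + load (γ ∧ φ′) ℕ.< weight k)
      (#sat-split IO.representatives γ φ′)
      (weight-split
        (satisfiable⇒#sat-pos (γ ∧ ¬̇ φ′)
          (invariant-∧ γ (¬̇ φ′) (inv t) (invariant-¬ φ′ φ′-invariant)) sat⁻)
        (satisfiable⇒#sat-pos (γ ∧ φ′) (invariant-∧ γ φ′ (inv t) φ′-invariant) sat⁺))

  module _ {n : ℕ} (N : DPN P n V) (inv : InvariantGuards N)
           (cond : Fin n → Φ (Fin V)) (ic : ∀ t → IsInputCondition N t (cond t)) where

    τ-CCG-exists : CCG (τ-DPN N cond) M-I α-I M-F
    τ-CCG-exists = CoverabilityGraph.CCG-exists em C (τTransitions-complete N) (τ-DPN N cond)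
      (τ-invariant N inv cond ic) M-I α-I α-I∈C M-F

    module _ (G : CCG (τ-DPN N cond) M-I α-I M-F) where

      open CCG G using (arcs; constraint)
      open Repair em (τ-DPN N cond) isτ G

      repaired-τ-invariant : InvariantGuards (MakeRepairStep em (τ-DPN N cond) isτ G)
      repaired-τ-invariant =
        repair-invariant (τTransitions-complete N) (τ-DPN N cond) (τ-invariant N inv cond ic) isτ G

      repair-decreases : Mixed G → size (removeτ (MakeRepairStep em (τ-DPN N cond) isτ G)) ℕ.< size N
      repair-decreases mixed with Paths.critical-exists em G mixed
      ... | a , a∈ , critical with CriticalArcs.critical-restricts em N cond G a∈ critical
      ... | u , restricted , θ , θ⊨g , θ⊨φ with IO.representative θ
      ... | r , r∈ , r∼θ =
        sum-decrease (load ∘ repaired ∘ inj₁) (load ∘ guard N) u 0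
          (λ t _ → weight-mono (#sat-mono IO.representatives {repaired (inj₁ t)} {guard N t}
                                 (repaired⇒guard (inj₁ t))))
          -- `θ` satisfies the old guard and violates the repaired one; invariance of the two guards
          -- carries this over to the representative `r`.
          (weight-strict (#sat-strict {φ = repaired (inj₁ u)} {guard N u}
            (repaired⇒guard (inj₁ u)) r∈
            (inv u (∼-sym r∼θ) θ⊨g)
            (λ h → repaired-excludes (inj₁ u) a∈ critical restricted
                     (repaired-τ-invariant (inj₁ u) r∼θ h) θ⊨φ)))

  -- Progress and termination of the loop

  color-cases : ∀ {T : Set} {N : Net P V T} (G : CCG N M-I α-I M-F) → Mixed G ⊎ AllGreen G ⊎ AllRed G
  color-cases G with decide em (∃[ i ] CCG.color G i ≡ green) | decide em (∃[ i ] CCG.color G i ≡ red)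
  ... | yes g | yes r = inj₁ (g , r)
  ... | _     | no ¬r = inj₂ (inj₁ λ i → not-red (λ r → ¬r (i , r)))
    where
    not-red : ∀ {c} → c ≢ red → c ≡ green
    not-red {red}   h = contradiction refl h
    not-red {green} h = refl
  ... | no ¬g | _     = inj₂ (inj₂ λ i → not-green (λ g → ¬g (i , g)))
    where
    not-green : ∀ {c} → c ≢ green → c ≡ red
    not-green {red}   h = refl
    not-green {green} h = contradiction refl h

  -- If no split is possible, the net is refined; input conditions and the graph then exist, and its
  -- coloring selects one of the three remaining steps.
  loop-progress : ∀ W → InvariantGuards (net W) → ∃[ σ ] looping W ⟶ σ
  loop-progress W inv with em {∃[ W′ ] Splits M-I α-I W W′}
  ... | yes (W′ , s) = looping W′ , refine s
  ... | no ∄s with inputConditions-exist (net W) inv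
  ...   | cond , ic with τ-CCG-exists (net W) inv cond ic
  ...     | G with color-cases G
  ...       | inj₁ mixed           = _ , repair (λ W′ s → ∄s (W′ , s)) ic G mixed
  ...       | inj₂ (inj₁ allGreen) = _ , succeed (λ W′ s → ∄s (W′ , s)) ic G allGreen
  ...       | inj₂ (inj₂ allRed)   = _ , fail (λ W′ s → ∄s (W′ , s)) ic G allRed

  loop-terminates : ∀ W → InvariantGuards (net W) → Acc ℕ._<_ (size (net W)) →
                    TerminatesFrom (looping W)
  loop-terminates W inv (acc rs) = continue (loop-progress W inv) λ
    { _ (refine {W′ = W′} s) →
        loop-terminates W′ (split-invariant inv s) (rs (split-decreases inv s))
    ; _ (repair _ {cond} ic G mixed) →
        loop-terminates _ (repaired-τ-invariant (net W) inv cond ic G ∘ inj₁)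
          (rs (repair-decreases (net W) inv cond ic G mixed))
    ; _ (succeed _ _ _ _) → returned
    ; _ (fail _ _ _ _)    → returned }

  source-invariant : InvariantGuards N
  source-invariant t = constants⊆⇒invariant (guard N t) (constants⊆C t)

  terminates : Terminates
  terminates = continue
    (_ , prepare (CoverabilityGraph.CCG-exists em C ∈-allFin N source-invariant M-I α-I α-I∈C M-F)) λ
    -- The preparatory repair happens once, so the measure starts with its result.
    { _ (prepare G) → loop-terminates _ (repair-invariant ∈-allFin N source-invariant (const false) G)
                        (ℕ.<-wellFounded _) }

proposition4p4 : (em : ExcludedMiddle (Level.suc 0ℓ)) →
    ∀ {P T V : ℕ} (N : DPN P T V)
    (M-I : Marking P) (α-I : Valuation V) (M-F : Marking P) →
    RepairDPN.Terminates em N M-I α-I M-F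
proposition4p4 = Termination.terminates
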